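{- Let $P_n$ be the path on $n>2$ vertices $1,\dots,n$ with edges $e_i=\{i,i+1\}$ ($1\le i\le n-1$), let $f_j=\{j,j+2\}$ ($1\le j\le n-2$), let $B=\{e_1,f_1,\dots,e_{n-2},f_{n-2},e_{n-1}\}$, and let $\mathfrak{D}_{P_n}=\mathfrak{D}_2(P_n)[B,B]$. Write $\det(xI-\mathfrak{D}_{P_n})=\sum_{i=0}^{2n-3}a_ix^i$. If $|a_\ell|=\max\{|a_0|,|a_1|,\dots,|a_{2n-4}|\}$, then $\ell\le\lfloor\frac{7n}{5}\rfloor$.
   Context: For a tree $T$, let $\mathcal{V}_2$ be the set of 2-element vertex subsets (edges regarded as elements of $\mathcal{V}_2$). The 2-Steiner distance matrix $\mathfrak{D}_2(T)$ is indexed by $\mathcal{V}_2$, with entry in row $\{i,j\}$, column $\{k,l\}$ equal to the minimum number of edges of a connected subtree of $T$ whose vertex set contains $i,j,k,l$. $M[B,B]$ denotes the principal submatrix with rows and columns indexed by $B$. -}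

module Defs where

open import Algebra.Bundles using (RawRing)
import Algebra.Definitions.RawSemiring as RawSemiringDefs
open import Data.Empty using (⊥)
open import Data.Fin using (Fin; zero; suc; inject₁; fromℕ; toℕ; punchIn)
open import Data.Fin.Properties using (_≟_; suc-injective)
open import Data.Fin.Subset using (Subset; ⁅_⁆; _∪_; ∣_∣; _∈_; _⊆_)
open import Data.Fin.Subset.Properties using (∣⁅x⁆∣≡1; ∪-identityˡ; ∪-identityʳ)
open import Data.Integer using (ℤ; 0ℤ; 1ℤ) renaming (_+_ to _+ℤ_; _*_ to _*ℤ_; -_ to -ℤ_)
open import Data.List using (List; []; _∷_; _++_; map; length; lookup; concatMap; allFin)
import Data.List.Membership.Propositional as List∈
open import Data.List.Relation.Unary.All using (All)
open import Data.List.Relation.Unary.Unique.Propositional using (Unique)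
open import Data.Nat using (ℕ; zero; suc; _≤_)
open import Data.Product using (Σ; ∃; _×_; _,_; proj₁)
open import Level using (0ℓ)
open import Relation.Binary.Construct.Closure.ReflexiveTransitive using (Star)
open import Relation.Binary.PropositionalEquality using (_≡_; _≢_; refl; trans; cong)
open import Relation.Nullary using (yes; no; contradiction)

𝒱₂ : ℕ → Set
𝒱₂ n = Σ (Subset n) λ S → ∣ S ∣ ≡ 2

∣pair∣≡2 : ∀ {n} (i j : Fin n) → i ≢ j → ∣ ⁅ i ⁆ ∪ ⁅ j ⁆ ∣ ≡ 2
∣pair∣≡2 zero    zero    i≢j = contradiction refl i≢j
∣pair∣≡2 zero    (suc j) i≢j = cong suc (trans (cong ∣_∣ (∪-identityˡ ⁅ j ⁆)) (∣⁅x⁆∣≡1 j))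
∣pair∣≡2 (suc i) zero    i≢j = cong suc (trans (cong ∣_∣ (∪-identityʳ ⁅ i ⁆)) (∣⁅x⁆∣≡1 i))
∣pair∣≡2 (suc i) (suc j) i≢j = ∣pair∣≡2 i j λ i≡j → i≢j (cong suc i≡j)

pair : ∀ {n} (i j : Fin n) → i ≢ j → 𝒱₂ n
pair i j i≢j = ⁅ i ⁆ ∪ ⁅ j ⁆ , ∣pair∣≡2 i j i≢j

-- The edge set of a simple graph on the vertex set Fin n.
Graph : ℕ → Set₁
Graph n = 𝒱₂ n → Set

-- If G is a tree, the connected subgraphs of G are exactly its subtrees
-- (up to the empty one, which contains no vertex).
record ConnectedSubgraph {n} (G : Graph n) : Set where
  field
    vertices : Subset n
    edges    : List (𝒱₂ n)
    unique   : Unique edges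
    edges⊆G  : All G edges
    ends     : All (λ e → proj₁ e ⊆ vertices) edges

  Adjacent : Fin n → Fin n → Set
  Adjacent u v = ∃ λ e → (e List∈.∈ edges) × (proj₁ e ≡ ⁅ u ⁆ ∪ ⁅ v ⁆)

  field
    connected : ∀ {u v} → u ∈ vertices → v ∈ vertices → Star Adjacent u v

open ConnectedSubgraph using (vertices; edges)

IsMinimum : (ℕ → Set) → ℕ → Set
IsMinimum P d = P d × (∀ k → P k → d ≤ k)

IsSteinerDistance : ∀ {n} → Graph n → Subset n → ℕ → Set
IsSteinerDistance G S = IsMinimum λ k →
  Σ (ConnectedSubgraph G) λ H → (S ⊆ vertices H) × (length (edges H) ≡ k)

-- Minima over types of subgraphs are specified rather than computed:
-- Is𝔇₂ G M says that M is the 2-Steiner distance matrix of G.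
Is𝔇₂ : ∀ {n} → Graph n → (𝒱₂ n → 𝒱₂ n → ℕ) → Set
Is𝔇₂ G M = ∀ p q → IsSteinerDistance G (proj₁ p ∪ proj₁ q) (M p q)

inject₁≢suc : ∀ {n} (i : Fin n) → inject₁ i ≢ suc i
inject₁≢suc zero    ()
inject₁≢suc (suc i) eq = inject₁≢suc i (suc-injective eq)

inject₁²≢suc² : ∀ {n} (j : Fin n) → inject₁ (inject₁ j) ≢ suc (suc j)
inject₁²≢suc² zero    ()
inject₁²≢suc² (suc j) eq = inject₁²≢suc² j (suc-injective eq)

-- Vertex k ∈ {1,…,n} is the element of Fin n with value k - 1, and the
-- indices of e and f are shifted by one likewise.
e : ∀ {m} → Fin m → 𝒱₂ (suc m)
e i = pair (inject₁ i) (suc i) (inject₁≢suc i)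

f : ∀ {m} → Fin m → 𝒱₂ (suc (suc m))
f j = pair (inject₁ (inject₁ j)) (suc (suc j)) (inject₁²≢suc² j)

Path : ∀ n → Graph n
Path zero    p = ⊥
Path (suc m) p = ∃ λ (i : Fin m) → p ≡ e i

-- e₁, f₁, …, eₙ₋₂, fₙ₋₂, eₙ₋₁; only the values for n > 2 matter.
B : ∀ n → List (𝒱₂ n)
B zero          = []
B (suc zero)    = []
B (suc (suc m)) = concatMap (λ j → e (inject₁ j) ∷ f j ∷ []) (allFin m) ++ e (fromℕ m) ∷ []

-- M[L,L] for a duplicate-free list L of indices, in the order of L.
principal : ∀ {I A : Set} → (I → I → A) → (L : List I) → Fin (length L) → Fin (length L) → A
principal M L r c = M (lookup L r) (lookup L c)

module Determinant {a ℓ} (R : RawRing a ℓ) where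
  open RawRing R
  open RawSemiringDefs rawSemiring using (sum; _^_)

  -- Laplace expansion along the first row.
  det : ∀ {n} → (Fin n → Fin n → Carrier) → Carrier
  det {zero}  M = 1#
  det {suc n} M = sum λ (j : Fin (suc n)) →
    (- 1#) ^ toℕ j * (M zero j * det (λ r c → M (suc r) (punchIn j c)))

-- Coefficient lists, constant term first; trailing zeros are allowed.
Poly : Set
Poly = List ℤ

coeff : Poly → ℕ → ℤ
coeff []      _       = 0ℤ
coeff (a ∷ p) zero    = a
coeff (a ∷ p) (suc i) = coeff p i

infixl 6 _+ₚ_
infixl 7 _*ₚ_

_+ₚ_ : Poly → Poly → Poly
[]      +ₚ q       = q
(a ∷ p) +ₚ []      = a ∷ p
(a ∷ p) +ₚ (b ∷ q) = (a +ℤ b) ∷ (p +ₚ q)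

_*ₚ_ : Poly → Poly → Poly
[]      *ₚ q = []
(a ∷ p) *ₚ q = map (a *ℤ_) q +ₚ (0ℤ ∷ (p *ₚ q))

-ₚ_ : Poly → Poly
-ₚ_ = map -ℤ_

const : ℤ → Poly
const a = a ∷ []

X : Poly
X = 0ℤ ∷ 1ℤ ∷ []

ℤ[X] : RawRing 0ℓ 0ℓ
ℤ[X] = record
  { Carrier = Poly
  ; _≈_     = λ p q → ∀ i → coeff p i ≡ coeff q i
  ; _+_     = _+ₚ_
  ; _*_     = _*ₚ_
  ; -_      = -ₚ_
  ; 0#      = []
  ; 1#      = const 1ℤ
  }

XI : ∀ {m} → Fin m → Fin m → Poly
XI i j with i ≟ j
... | yes _ = X
... | no  _ = []

charPoly : ∀ {m} → (Fin m → Fin m → ℤ) → Poly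
charPoly M = Determinant.det ℤ[X] λ i j → XI i j +ₚ (-ₚ const (M i j))

{-# OPTIONS --safe #-}
module Submission where

-- Numbering the vertices from 0, the r-th member of B is the interval from
-- ⌊r/2⌋ to 1 + ⌈r/2⌉, and the Steiner distance of two intervals of a path is
-- the length of their hull.  The difference of two consecutive columns of
-- this matrix is constant above and below the diagonal.  Hence, after
-- bordering xI - 𝔇 with a column of ones, column operations make the matrix
-- lower Hessenberg up to its first two columns, and expanding along the first
-- row changes only these two columns, inside a space of dimension four.  This
-- gives a linear recurrence for the characteristic polynomial P of order
-- m = 2h + 1 (h = n - 2), and solving it yields
--
--   (4x+1)² (x^m - P) = x^2h (8x³ - x) + ((8h+24)x² + (6h+11)x + h+1) B - (8x³ + 8x² + 2x) A
--
-- where A and B have degree 2h and the coefficients C(2h+j, 2j) and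
-- C(2h+1+j, 2j+1) at x^(2h-j).  Write q_j and Q_j for the coefficients of
-- x^m - P and of the right-hand side, both counted from the top.  For j up to
-- about 2h/3 the numbers Q_j at least double with j, and then
-- 16 q_j + 8 q_(j-1) + q_(j-2) = Q_j forces q_j > q_(j-1) ≥ 0.  So the
-- absolute values of the coefficients of P decrease strictly beyond x^(7n/5).

-- The factor (4x + 1)² and the coefficients linear in h have one source. A level of the recurrence
-- acts on (A, B) by a matrix of trace 2x + 1 and determinant x², so the discriminant is 4x + 1. Two
-- further sequences, `seqK` and `seqJ`, are moved by the same matrix and forced by terms in B: this
-- resonance yields the terms in h. The remaining one, `seqG`, is multiplied by x² over two levels
-- and forced by B. The characteristic polynomial of the matrix takes the values -x at x and x(4x +
-- 1) at -x, so x² meets the square of an eigenvalue only where x(4x + 1) = 0, which brings in 4x +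
-- 1 once more. The limit 2h/3 comes from the ratio (2h+j+2)(2h-j) / ((2j+2)(2j+3)) of neighbouring
-- coefficients of B, which is close to 2 at j = 2h/3.

open import Algebra.Bundles using (CommutativeRing)
open import Algebra.Solver.Ring.AlmostCommutativeRing using (_-Raw-AlmostCommutative⟶_; fromCommutativeRing)
import Data.Integer.Properties as ℤP
open import Level using (0ℓ)

-- The commutative ring of integer polynomials.

module Polynomials where
  open import Defs
  open import Data.Integer using (0ℤ; 1ℤ)
  import Data.Integer as ℤ
  open import Data.List using ([]; _∷_; map)
  open import Data.Nat using (zero; suc)
  open import Data.Product using (_,_)
  open import Relation.Binary.PropositionalEquality using (_≡_; refl; sym; trans; cong; cong₂)
  open import Relation.Binary.Bundles using (Setoid)
  open import Relation.Binary.Structures using (IsEquivalence)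

  coeff-+ : ∀ p q i → coeff (p +ₚ q) i ≡ coeff p i ℤ.+ coeff q i
  coeff-+ []      q       i       = sym (ℤP.+-identityˡ _)
  coeff-+ (a ∷ p) []      i       = sym (ℤP.+-identityʳ _)
  coeff-+ (a ∷ p) (b ∷ q) zero    = refl
  coeff-+ (a ∷ p) (b ∷ q) (suc i) = coeff-+ p q i

  coeff-scale : ∀ a p i → coeff (map (a ℤ.*_) p) i ≡ a ℤ.* coeff p i
  coeff-scale a []      i       = sym (ℤP.*-zeroʳ a)
  coeff-scale a (b ∷ p) zero    = refl
  coeff-scale a (b ∷ p) (suc i) = coeff-scale a p i

  coeff-neg : ∀ p i → coeff (-ₚ p) i ≡ ℤ.- coeff p i
  coeff-neg []      i       = refl
  coeff-neg (a ∷ p) zero    = refl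
  coeff-neg (a ∷ p) (suc i) = coeff-neg p i

  infix 4 _≋_

  -- A record, so that p and q can be inferred from a proof of p ≋ q.
  record _≋_ (p q : Poly) : Set where
    constructor coeffwise
    field at : ∀ i → coeff p i ≡ coeff q i

  open _≋_

  ≋-isEquivalence : IsEquivalence _≋_
  ≋-isEquivalence = record
    { refl  = coeffwise λ _ → refl
    ; sym   = λ e → coeffwise λ i → sym (at e i)
    ; trans = λ e e′ → coeffwise λ i → trans (at e i) (at e′ i)
    }

  ≋-setoid : Setoid 0ℓ 0ℓ
  ≋-setoid = record { isEquivalence = ≋-isEquivalence }

  open IsEquivalence ≋-isEquivalence using () renaming (refl to ≋-refl; sym to ≋-sym; trans to ≋-trans)
  open import Relation.Binary.Reasoning.Setoid ≋-setoid

  ∷-cong : ∀ {a b p q} → a ≡ b → p ≋ q → (a ∷ p) ≋ (b ∷ q)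
  ∷-cong a≡b p≋q = coeffwise λ { zero → a≡b ; (suc i) → at p≋q i }

  0∷[]≋[] : (0ℤ ∷ []) ≋ []
  0∷[]≋[] = coeffwise λ { zero → refl ; (suc i) → refl }

  +ₚ-cong : ∀ {p p′ q q′} → p ≋ p′ → q ≋ q′ → p +ₚ q ≋ p′ +ₚ q′
  +ₚ-cong {p} {p′} {q} {q′} e e′ = coeffwise λ i →
    trans (coeff-+ p q i) (trans (cong₂ ℤ._+_ (at e i) (at e′ i)) (sym (coeff-+ p′ q′ i)))

  -ₚ-cong : ∀ {p q} → p ≋ q → -ₚ p ≋ -ₚ q
  -ₚ-cong {p} {q} e = coeffwise λ i →
    trans (coeff-neg p i) (trans (cong ℤ.-_ (at e i)) (sym (coeff-neg q i)))

  scale-cong : ∀ {a p q} → p ≋ q → map (a ℤ.*_) p ≋ map (a ℤ.*_) q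
  scale-cong {a} {p} {q} e = coeffwise λ i →
    trans (coeff-scale a p i) (trans (cong (a ℤ.*_) (at e i)) (sym (coeff-scale a q i)))

  +ₚ-comm : ∀ p q → p +ₚ q ≋ q +ₚ p
  +ₚ-comm p q = coeffwise λ i →
    trans (coeff-+ p q i) (trans (ℤP.+-comm (coeff p i) (coeff q i)) (sym (coeff-+ q p i)))

  +ₚ-assoc : ∀ p q r → (p +ₚ q) +ₚ r ≋ p +ₚ (q +ₚ r)
  +ₚ-assoc p q r = coeffwise λ i → trans (coeff-+ (p +ₚ q) r i)
    (trans (cong (ℤ._+ coeff r i) (coeff-+ p q i)) (trans (ℤP.+-assoc (coeff p i) _ _)
    (trans (cong (ℤ._+_ (coeff p i)) (sym (coeff-+ q r i))) (sym (coeff-+ p (q +ₚ r) i)))))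

  +ₚ-identityʳ : ∀ p → p +ₚ [] ≋ p
  +ₚ-identityʳ p = +ₚ-comm p []

  -ₚ-inverseˡ : ∀ p → (-ₚ p) +ₚ p ≋ []
  -ₚ-inverseˡ p = coeffwise λ i → trans (coeff-+ (-ₚ p) p i)
    (trans (cong (ℤ._+ coeff p i) (coeff-neg p i)) (ℤP.+-inverseˡ (coeff p i)))

  +ₚ-exchange : ∀ p q r → p +ₚ (q +ₚ r) ≋ q +ₚ (p +ₚ r)
  +ₚ-exchange p q r = ≋-trans (≋-sym (+ₚ-assoc p q r))
    (≋-trans (+ₚ-cong (+ₚ-comm p q) ≋-refl) (+ₚ-assoc q p r))

  scale-distrib-+ : ∀ a p q → map (a ℤ.*_) (p +ₚ q) ≋ map (a ℤ.*_) p +ₚ map (a ℤ.*_) q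
  scale-distrib-+ a p q = coeffwise λ i → trans (coeff-scale a (p +ₚ q) i)
    (trans (cong (a ℤ.*_) (coeff-+ p q i)) (trans (ℤP.*-distribˡ-+ a _ _)
    (trans (sym (cong₂ ℤ._+_ (coeff-scale a p i) (coeff-scale a q i)))
           (sym (coeff-+ (map (a ℤ.*_) p) _ i)))))

  scale-distrib-+ˡ : ∀ a b p → map ((a ℤ.+ b) ℤ.*_) p ≋ map (a ℤ.*_) p +ₚ map (b ℤ.*_) p
  scale-distrib-+ˡ a b p = coeffwise λ i → trans (coeff-scale (a ℤ.+ b) p i)
    (trans (ℤP.*-distribʳ-+ (coeff p i) a b)
    (trans (sym (cong₂ ℤ._+_ (coeff-scale a p i) (coeff-scale b p i)))
           (sym (coeff-+ (map (a ℤ.*_) p) _ i))))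

  scale-scale : ∀ a b p → map ((a ℤ.* b) ℤ.*_) p ≋ map (a ℤ.*_) (map (b ℤ.*_) p)
  scale-scale a b p = coeffwise λ i → trans (coeff-scale (a ℤ.* b) p i)
    (trans (ℤP.*-assoc a b _) (trans (cong (a ℤ.*_) (sym (coeff-scale b p i)))
                                     (sym (coeff-scale a (map (b ℤ.*_) p) i))))

  scale-0 : ∀ p → map (0ℤ ℤ.*_) p ≋ []
  scale-0 p = coeffwise λ i → trans (coeff-scale 0ℤ p i) (ℤP.*-zeroˡ (coeff p i))

  scale-1 : ∀ p → map (1ℤ ℤ.*_) p ≋ p
  scale-1 p = coeffwise λ i → trans (coeff-scale 1ℤ p i) (ℤP.*-identityˡ (coeff p i))

  *ₚ-zeroʳ : ∀ p → p *ₚ [] ≋ []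
  *ₚ-zeroʳ []      = ≋-refl
  *ₚ-zeroʳ (a ∷ p) = ≋-trans (∷-cong refl (*ₚ-zeroʳ p)) 0∷[]≋[]

  -- The mirror image of the defining recursion; with it, commutativity is a plain induction.
  *ₚ-∷ʳ : ∀ p b q → p *ₚ (b ∷ q) ≋ map (b ℤ.*_) p +ₚ (0ℤ ∷ (p *ₚ q))
  *ₚ-∷ʳ []      b q = ≋-sym 0∷[]≋[]
  *ₚ-∷ʳ (a ∷ p) b q = ∷-cong (cong (ℤ._+ 0ℤ) (ℤP.*-comm a b)) (begin
    map (a ℤ.*_) q +ₚ p *ₚ (b ∷ q)                          ≈⟨ +ₚ-cong ≋-refl (*ₚ-∷ʳ p b q) ⟩
    map (a ℤ.*_) q +ₚ (map (b ℤ.*_) p +ₚ (0ℤ ∷ (p *ₚ q)))   ≈⟨ +ₚ-exchange (map (a ℤ.*_) q) (map (b ℤ.*_) p) (0ℤ ∷ (p *ₚ q)) ⟩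
    map (b ℤ.*_) p +ₚ (map (a ℤ.*_) q +ₚ (0ℤ ∷ (p *ₚ q)))   ∎)

  *ₚ-comm : ∀ p q → p *ₚ q ≋ q *ₚ p
  *ₚ-comm []      q = ≋-sym (*ₚ-zeroʳ q)
  *ₚ-comm (a ∷ p) q = ≋-trans (+ₚ-cong ≋-refl (∷-cong refl (*ₚ-comm p q))) (≋-sym (*ₚ-∷ʳ q a p))

  *ₚ-congˡ : ∀ p {q q′} → q ≋ q′ → p *ₚ q ≋ p *ₚ q′
  *ₚ-congˡ []      e = ≋-refl
  *ₚ-congˡ (a ∷ p) e = +ₚ-cong (scale-cong {a} e) (∷-cong refl (*ₚ-congˡ p e))

  -- The product recurses on its left factor, and equal polynomials may be lists of different
  -- lengths, so congruence in that factor is obtained through commutativity.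
  *ₚ-cong : ∀ {p p′ q q′} → p ≋ p′ → q ≋ q′ → p *ₚ q ≋ p′ *ₚ q′
  *ₚ-cong {p} {p′} {q} {q′} e e′ = begin
    p *ₚ q    ≈⟨ *ₚ-congˡ p e′ ⟩
    p *ₚ q′   ≈⟨ *ₚ-comm p q′ ⟩
    q′ *ₚ p   ≈⟨ *ₚ-congˡ q′ e ⟩
    q′ *ₚ p′  ≈⟨ *ₚ-comm q′ p′ ⟩
    p′ *ₚ q′  ∎

  +ₚ-interchange : ∀ p q r s → (p +ₚ q) +ₚ (r +ₚ s) ≋ (p +ₚ r) +ₚ (q +ₚ s)
  +ₚ-interchange p q r s = ≋-trans (+ₚ-assoc p q (r +ₚ s))
    (≋-trans (+ₚ-cong {p} ≋-refl (+ₚ-exchange q r s)) (≋-sym (+ₚ-assoc p r (q +ₚ s))))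

  *ₚ-distribʳ-+ : ∀ r p q → (p +ₚ q) *ₚ r ≋ p *ₚ r +ₚ q *ₚ r
  *ₚ-distribʳ-+ r []      q       = ≋-refl
  *ₚ-distribʳ-+ r (a ∷ p) []      = ≋-sym (+ₚ-identityʳ _)
  *ₚ-distribʳ-+ r (a ∷ p) (b ∷ q) = begin
    map ((a ℤ.+ b) ℤ.*_) r +ₚ (0ℤ ∷ ((p +ₚ q) *ₚ r))
      ≈⟨ +ₚ-cong (scale-distrib-+ˡ a b r) (∷-cong refl (*ₚ-distribʳ-+ r p q)) ⟩
    (map (a ℤ.*_) r +ₚ map (b ℤ.*_) r) +ₚ (0ℤ ∷ (p *ₚ r +ₚ q *ₚ r))
      ≈⟨ +ₚ-interchange (map (a ℤ.*_) r) _ _ _ ⟩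
    (map (a ℤ.*_) r +ₚ (0ℤ ∷ (p *ₚ r))) +ₚ (map (b ℤ.*_) r +ₚ (0ℤ ∷ (q *ₚ r))) ∎

  *ₚ-distribˡ-+ : ∀ r p q → r *ₚ (p +ₚ q) ≋ r *ₚ p +ₚ r *ₚ q
  *ₚ-distribˡ-+ r p q = ≋-trans (*ₚ-comm r (p +ₚ q))
    (≋-trans (*ₚ-distribʳ-+ r p q) (+ₚ-cong (*ₚ-comm p r) (*ₚ-comm q r)))

  scale-*ₚ : ∀ a p q → map (a ℤ.*_) p *ₚ q ≋ map (a ℤ.*_) (p *ₚ q)
  scale-*ₚ a []      q = ≋-refl
  scale-*ₚ a (b ∷ p) q = begin
    map ((a ℤ.* b) ℤ.*_) q +ₚ (0ℤ ∷ (map (a ℤ.*_) p *ₚ q))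
      ≈⟨ +ₚ-cong (scale-scale a b q) (∷-cong (sym (ℤP.*-zeroʳ a)) (scale-*ₚ a p q)) ⟩
    map (a ℤ.*_) (map (b ℤ.*_) q) +ₚ map (a ℤ.*_) (0ℤ ∷ (p *ₚ q))
      ≈⟨ scale-distrib-+ a (map (b ℤ.*_) q) _ ⟨
    map (a ℤ.*_) ((b ∷ p) *ₚ q) ∎

  *ₚ-assoc : ∀ p q r → (p *ₚ q) *ₚ r ≋ p *ₚ (q *ₚ r)
  *ₚ-assoc []      q r = ≋-refl
  *ₚ-assoc (a ∷ p) q r = begin
    (map (a ℤ.*_) q +ₚ (0ℤ ∷ (p *ₚ q))) *ₚ r
      ≈⟨ *ₚ-distribʳ-+ r (map (a ℤ.*_) q) _ ⟩
    map (a ℤ.*_) q *ₚ r +ₚ (map (0ℤ ℤ.*_) r +ₚ (0ℤ ∷ ((p *ₚ q) *ₚ r)))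
      ≈⟨ +ₚ-cong (scale-*ₚ a q r) (+ₚ-cong (scale-0 r) (∷-cong refl (*ₚ-assoc p q r))) ⟩
    map (a ℤ.*_) (q *ₚ r) +ₚ (0ℤ ∷ (p *ₚ (q *ₚ r))) ∎

  *ₚ-identityˡ : ∀ p → const 1ℤ *ₚ p ≋ p
  *ₚ-identityˡ p = ≋-trans (+ₚ-cong (scale-1 p) 0∷[]≋[]) (+ₚ-identityʳ p)

  polyRing : CommutativeRing 0ℓ 0ℓ
  polyRing = record
    { Carrier = Poly
    ; _≈_     = _≋_
    ; _+_     = _+ₚ_
    ; _*_     = _*ₚ_
    ; -_      = -ₚ_
    ; 0#      = []
    ; 1#      = const 1ℤ
    ; isCommutativeRing = record
      { isRing = record
        { +-isAbelianGroup = record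
          { isGroup = record
            { isMonoid = record
              { isSemigroup = record
                { isMagma = record { isEquivalence = ≋-isEquivalence ; ∙-cong = +ₚ-cong }
                ; assoc   = +ₚ-assoc
                }
              ; identity = (λ _ → ≋-refl) , +ₚ-identityʳ
              }
            ; inverse = -ₚ-inverseˡ , λ p → ≋-trans (+ₚ-comm p (-ₚ p)) (-ₚ-inverseˡ p)
            ; ⁻¹-cong = -ₚ-cong
            }
          ; comm = +ₚ-comm
          }
        ; *-cong     = *ₚ-cong
        ; *-assoc    = *ₚ-assoc
        ; *-identity = *ₚ-identityˡ , λ p → ≋-trans (*ₚ-comm p (const 1ℤ)) (*ₚ-identityˡ p)
        ; distrib    = *ₚ-distribˡ-+ , *ₚ-distribʳ-+
        }
      ; *-comm = *ₚ-comm
      }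
    }

-- Column operations on determinants.

module Determinants
  (R : CommutativeRing 0ℓ 0ℓ)
  (ℤ⟶R : CommutativeRing.rawRing ℤP.+-*-commutativeRing -Raw-AlmostCommutative⟶ fromCommutativeRing R)
  where

  open import Data.Empty using (⊥-elim)
  open import Data.Integer using (+_)
  open import Data.Maybe using (Maybe; just; nothing)
  open import Data.Nat using (ℕ; zero; suc; _≤_; _<_; s≤s; z<s; s<s; _≟_)
  import Data.Nat.Properties as ℕP
  open import Data.Product using (∃; _×_; _,_)
  open import Function using (_∘_)
  open import Relation.Binary.Definitions using (tri<; tri≈; tri>)
  open import Relation.Binary.PropositionalEquality as ≡ using (_≡_; _≢_)
  open import Relation.Nullary using (Dec; yes; no)

  open CommutativeRing R hiding (zero)
  open _-Raw-AlmostCommutative⟶_ ℤ⟶R renaming (⟦_⟧ to ι)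
  open import Relation.Binary.Reasoning.Setoid setoid

  ι-weaklyDecidable : ∀ a b → Maybe (ι a ≈ ι b)
  ι-weaklyDecidable a b with a ℤP.≟ b
  ... | yes a≡b = just (reflexive (≡.cong ι a≡b))
  ... | no  _   = nothing

  open import Algebra.Solver.Ring (CommutativeRing.rawRing ℤP.+-*-commutativeRing) (fromCommutativeRing R) ℤ⟶R ι-weaklyDecidable
    using (Polynomial; solve; _:=_; con; _:+_; _:*_; _:-_; :-_) public

  Vector Matrix : Set
  Vector = ℕ → Carrier
  -- Matrices are given by their columns, and only the leading block matters.
  Matrix = ℕ → Vector

  ∑ : ℕ → Vector → Carrier
  ∑ zero    f = 0#
  ∑ (suc n) f = f 0 + ∑ n (f ∘ suc)

  ∑-cong : ∀ n {f g : Vector} → (∀ j → j < n → f j ≈ g j) → ∑ n f ≈ ∑ n g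
  ∑-cong zero    f≈g = refl
  ∑-cong (suc n) f≈g = +-cong (f≈g 0 z<s) (∑-cong n λ j j<n → f≈g (suc j) (s<s j<n))

  ∑-zero : ∀ n {f : Vector} → (∀ j → j < n → f j ≈ 0#) → ∑ n f ≈ 0#
  ∑-zero zero    f≈0 = refl
  ∑-zero (suc n) f≈0 = trans (+-cong (f≈0 0 z<s) (∑-zero n λ j j<n → f≈0 (suc j) (s<s j<n))) (+-identityˡ 0#)

  ∑-linear : ∀ n t (f g : Vector) → ∑ n (λ j → f j + t * g j) ≈ ∑ n f + t * ∑ n g
  ∑-linear zero    t f g = sym (trans (+-identityˡ _) (zeroʳ t))
  ∑-linear (suc n) t f g = trans (+-congˡ (∑-linear n t (f ∘ suc) (g ∘ suc)))
    (solve 5 (λ t f g F G → (f :+ t :* g) :+ (F :+ t :* G) := (f :+ F) :+ t :* (g :+ G)) refl t _ _ _ _)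

  sgn : ℕ → Carrier
  sgn zero    = 1#
  sgn (suc j) = - sgn j

  skip : ℕ → ℕ → ℕ
  skip zero    c       = suc c
  skip (suc j) zero    = zero
  skip (suc j) (suc c) = suc (skip j c)

  skip-< : ∀ {s} j {c} → c < s → skip j c < suc s
  skip-< zero            c<s       = s<s c<s
  skip-< (suc j) {zero}  _         = z<s
  skip-< (suc j) {suc c} (s<s c<s) = s<s (skip-< j c<s)

  skip-≢ : ∀ j c → skip j c ≢ j
  skip-≢ (suc j) (suc c) eq = skip-≢ j c (ℕP.suc-injective eq)

  skip-injective : ∀ j {c d} → skip j c ≡ skip j d → c ≡ d
  skip-injective zero            eq = ℕP.suc-injective eq
  skip-injective (suc j) {zero}  {zero}  eq = ≡.refl
  skip-injective (suc j) {suc c} {suc d} eq = ≡.cong suc (skip-injective j (ℕP.suc-injective eq))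

  skip-below : ∀ {j c} → c < j → skip j c ≡ c
  skip-below {suc j} {zero}  _         = ≡.refl
  skip-below {suc j} {suc c} (s<s c<j) = ≡.cong suc (skip-below c<j)

  skip-above : ∀ {j c} → j ≤ c → skip j c ≡ suc c
  skip-above {zero}  _         = ≡.refl
  skip-above {suc j} {suc c} (s≤s j≤c) = ≡.cong suc (skip-above j≤c)

  skip-surjective : ∀ {s} j k → j ≢ k → j < suc s → k < suc s → ∃ λ k′ → k′ < s × skip j k′ ≡ k
  skip-surjective j k j≢k j<s k<s with ℕP.<-cmp j k
  ... | tri≈ _ j≡k _ = ⊥-elim (j≢k j≡k)
  ... | tri> _ _ k<j = k , ℕP.<-≤-trans k<j (ℕP.≤-pred j<s) , skip-below k<j
  skip-surjective j (suc k) _ _ k<s | tri< j<k _ _ = k , ℕP.≤-pred k<s , skip-above (ℕP.≤-pred j<k)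

  minor : ℕ → Matrix → Matrix
  minor j M c r = M (skip j c) (suc r)

  Det : ℕ → Matrix → Carrier
  Det zero    M = 1#
  Det (suc s) M = ∑ (suc s) λ j → sgn j * (M j 0 * Det s (minor j M))

  Det-cong : ∀ s {M N : Matrix} → (∀ c r → c < s → r < s → M c r ≈ N c r) → Det s M ≈ Det s N
  Det-cong zero    M≈N = refl
  Det-cong (suc s) M≈N = ∑-cong (suc s) λ j j<s → *-congˡ {sgn j} (*-cong (M≈N j 0 j<s z<s)
    (Det-cong s λ c r c<s r<s → M≈N (skip j c) (suc r) (skip-< j c<s) (s<s r<s)))

  infixl 20 _[_≔_]

  _[_≔_] : Matrix → ℕ → Vector → Matrix
  (M [ k ≔ v ]) c with c ≟ k
  ... | yes _ = v
  ... | no  _ = M c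

  ≔-here : ∀ M k v → (M [ k ≔ v ]) k ≡ v
  ≔-here M k v with k ≟ k
  ... | yes _   = ≡.refl
  ... | no  k≢k = ⊥-elim (k≢k ≡.refl)

  ≔-there : ∀ M k v {c} → c ≢ k → (M [ k ≔ v ]) c ≡ M c
  ≔-there M k v {c} c≢k with c ≟ k
  ... | yes c≡k = ⊥-elim (c≢k c≡k)
  ... | no  _   = ≡.refl

  minor-≔-here : ∀ M k v c r → minor k (M [ k ≔ v ]) c r ≡ minor k M c r
  minor-≔-here M k v c r = ≡.cong (λ u → u (suc r)) (≔-there M k v (skip-≢ k c))

  minor-≔-there : ∀ M j k′ v c r →
    minor j (M [ skip j k′ ≔ v ]) c r ≡ (minor j M [ k′ ≔ v ∘ suc ]) c r
  minor-≔-there M j k′ v c r with c ≟ k′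
  ... | yes ≡.refl = ≡.cong (λ u → u (suc r)) (≔-here M (skip j c) v)
  ... | no  c≢k′   = ≡.cong (λ u → u (suc r)) (≔-there M (skip j k′) v (c≢k′ ∘ skip-injective j))

  -- In the expansion along the first row, the term of column k sees the new column only through its
  -- top entry. Every other term sees it inside the minor, at the position k′ with `skip j k′ ≡ k`,
  -- where induction applies.
  Det-linear : ∀ s k → k < s → ∀ M (u v : Vector) t →
    Det s (M [ k ≔ (λ r → u r + t * v r) ]) ≈ Det s (M [ k ≔ u ]) + t * Det s (M [ k ≔ v ])
  Det-linear (suc s) k k<s M u v t = trans (∑-cong (suc s) term) (∑-linear (suc s) t (F u) (F v))
    where
    w : Vector
    w r = u r + t * v r
    F : Vector → ℕ → Carrier
    F z j = sgn j * ((M [ k ≔ z ]) j 0 * Det s (minor j (M [ k ≔ z ])))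
    here : ∀ z → F z k ≈ sgn k * (z 0 * Det s (minor k M))
    here z = *-congˡ (*-cong (reflexive (≡.cong (λ u → u 0) (≔-here M k z)))
      (Det-cong s λ c r _ _ → reflexive (minor-≔-here M k z c r)))
    there : ∀ z j k′ → j ≢ k → skip j k′ ≡ k → F z j ≈ sgn j * (M j 0 * Det s (minor j M [ k′ ≔ z ∘ suc ]))
    there z j k′ j≢k ≡.refl = *-congˡ (*-cong (reflexive (≡.cong (λ u → u 0) (≔-there M k z j≢k)))
      (Det-cong s λ c r _ _ → reflexive (minor-≔-there M j k′ z c r)))
    atColumn : F w k ≈ F u k + t * F v k
    atColumn = begin
      F w k                                        ≈⟨ here w ⟩
      sgn k * ((u 0 + t * v 0) * D)
        ≈⟨ solve 5 (λ s u v t D → s :* ((u :+ t :* v) :* D) := s :* (u :* D) :+ t :* (s :* (v :* D))) refl _ _ _ _ _ ⟩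
      sgn k * (u 0 * D) + t * (sgn k * (v 0 * D))  ≈⟨ +-cong (here u) (*-congˡ (here v)) ⟨
      F u k + t * F v k                            ∎
      where D = Det s (minor k M)
    offColumn : ∀ j k′ → k′ < s → j ≢ k → skip j k′ ≡ k → F w j ≈ F u j + t * F v j
    offColumn j k′ k′<s j≢k eq = begin
      F w j
        ≈⟨ there w j k′ j≢k eq ⟩
      sgn j * (M j 0 * Det s (minor j M [ k′ ≔ w ∘ suc ]))
        ≈⟨ *-congˡ (*-congˡ (Det-linear s k′ k′<s (minor j M) (u ∘ suc) (v ∘ suc) t)) ⟩
      sgn j * (M j 0 * (U + t * V))
        ≈⟨ solve 5 (λ s m t U V → s :* (m :* (U :+ t :* V)) := s :* (m :* U) :+ t :* (s :* (m :* V))) refl _ _ _ _ _ ⟩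
      sgn j * (M j 0 * U) + t * (sgn j * (M j 0 * V))
        ≈⟨ +-cong (there u j k′ j≢k eq) (*-congˡ (there v j k′ j≢k eq)) ⟨
      F u j + t * F v j ∎
      where
      U = Det s (minor j M [ k′ ≔ u ∘ suc ])
      V = Det s (minor j M [ k′ ≔ v ∘ suc ])
    byColumn : ∀ j → j < suc s → Dec (j ≡ k) → F w j ≈ F u j + t * F v j
    byColumn j j<s (yes ≡.refl) = atColumn
    byColumn j j<s (no j≢k) with k′ , k′<s , eq ← skip-surjective j k j≢k j<s k<s = offColumn j k′ k′<s j≢k eq
    term : ∀ j → j < suc s → F w j ≈ F u j + t * F v j
    term j j<s = byColumn j j<s (j ≟ k)

  ∑-adjacent : ∀ n k {f : Vector} → suc k < n → f k + f (suc k) ≈ 0# →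
    (∀ j → j < n → j ≢ k → j ≢ suc k → f j ≈ 0#) → ∑ n f ≈ 0#
  ∑-adjacent (suc (suc n)) zero _ cancel rest =
    trans (sym (+-assoc _ _ _)) (trans (+-cong cancel (∑-zero n λ j j<n → rest _ (s<s (s<s j<n)) (λ ()) (λ ()))) (+-identityˡ 0#))
  ∑-adjacent (suc n) (suc k) (s<s k<n) cancel rest =
    trans (+-cong (rest 0 z<s (λ ()) (λ ())) (∑-adjacent n k k<n cancel
      λ j j<n j≢k j≢k′ → rest (suc j) (s<s j<n) (j≢k ∘ ℕP.suc-injective) (j≢k′ ∘ ℕP.suc-injective))) (+-identityˡ 0#)

  x*y*0≈0 : ∀ x y {z} → z ≈ 0# → x * (y * z) ≈ 0#
  x*y*0≈0 x y z≈0 = trans (*-congˡ (trans (*-congˡ z≈0) (zeroʳ y))) (zeroʳ x)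

  predecessor : ∀ {j k} → j < k → ∃ λ k′ → k ≡ suc k′ × j ≤ k′
  predecessor {k = suc k′} (s≤s j≤k′) = k′ , ≡.refl , j≤k′

  -- The two minors that delete one of the equal columns coincide and enter with opposite signs;
  -- every other minor still has two equal adjacent columns.
  Det-adjacent : ∀ s k → suc k < s → ∀ M → (∀ r → M k r ≈ M (suc k) r) → Det s M ≈ 0#
  Det-adjacent (suc s) k k<s M eq = ∑-adjacent (suc s) k k<s cancel rest
    where
    same : ∀ c r → minor k M c r ≈ minor (suc k) M c r
    same c r with ℕP.<-cmp c k
    ... | tri< c<k _ _ rewrite skip-below c<k | skip-below (ℕP.m<n⇒m<1+n c<k) = refl
    ... | tri≈ _ ≡.refl _ rewrite skip-above (ℕP.≤-refl {c}) | skip-below (ℕP.n<1+n c) = sym (eq (suc r))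
    ... | tri> _ _ k<c rewrite skip-above (ℕP.<⇒≤ k<c) | skip-above k<c = refl
    cancel : sgn k * (M k 0 * Det s (minor k M)) + - sgn k * (M (suc k) 0 * Det s (minor (suc k) M)) ≈ 0#
    cancel = begin
      sgn k * (M k 0 * Det s (minor k M)) + - sgn k * (M (suc k) 0 * Det s (minor (suc k) M))
        ≈⟨ +-congʳ (*-congˡ (*-cong (eq 0) (Det-cong s λ c r _ _ → same c r))) ⟩
      sgn k * X + - sgn k * X
        ≈⟨ solve 2 (λ s X → s :* X :+ :- s :* X := con (+ 0)) refl (sgn k) X ⟩
      ι (+ 0) ≈⟨ 0-homo ⟩
      0# ∎
      where X = M (suc k) 0 * Det s (minor (suc k) M)
    vanish : ∀ j k′ → suc k′ < s → skip j k′ ≡ k → skip j (suc k′) ≡ suc k → Det s (minor j M) ≈ 0#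
    vanish j k′ k′<s e e′ = Det-adjacent s k′ k′<s (minor j M) λ r →
      trans (reflexive (≡.cong (λ c → M c (suc r)) e)) (trans (eq (suc r)) (sym (reflexive (≡.cong (λ c → M c (suc r)) e′))))
    minor≈0 : ∀ j → j < suc s → j ≢ k → j ≢ suc k → Det s (minor j M) ≈ 0#
    minor≈0 j j<s j≢k j≢k′ with ℕP.<-cmp j k
    ... | tri≈ _ j≡k _ = ⊥-elim (j≢k j≡k)
    ... | tri> _ _ k<j = vanish j k (ℕP.<-≤-trans k+1<j (ℕP.≤-pred j<s)) (skip-below k<j) (skip-below k+1<j)
      where k+1<j = ℕP.≤∧≢⇒< k<j (j≢k′ ∘ ≡.sym)
    ... | tri< j<k _ _ with k′ , eq′ , j≤k′ ← predecessor j<k =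
      vanish j k′ (ℕP.≤-pred (≡.subst (λ k → suc k < suc s) eq′ k<s))
        (≡.trans (skip-above j≤k′) (≡.sym eq′))
        (≡.trans (skip-above (ℕP.m≤n⇒m≤1+n j≤k′)) (≡.cong suc (≡.sym eq′)))
    rest : ∀ j → j < suc s → j ≢ k → j ≢ suc k → sgn j * (M j 0 * Det s (minor j M)) ≈ 0#
    rest j j<s j≢k j≢k′ = x*y*0≈0 (sgn j) (M j 0) (minor≈0 j j<s j≢k j≢k′)

  Det-add : ∀ s k → k < s → ∀ M (u v : Vector) →
    Det s (M [ k ≔ (λ r → u r + v r) ]) ≈ Det s (M [ k ≔ u ]) + Det s (M [ k ≔ v ])
  Det-add s k k<s M u v = trans (Det-cong s λ c r _ _ → one c r)
    (trans (Det-linear s k k<s M u v 1#) (+-congˡ (*-identityˡ _)))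
    where
    one : ∀ c r → (M [ k ≔ (λ r → u r + v r) ]) c r ≈ (M [ k ≔ (λ r → u r + 1# * v r) ]) c r
    one c r with c ≟ k
    ... | yes _ = +-congˡ (sym (*-identityˡ _))
    ... | no  _ = refl

  -- Polarisation: the determinant with u + v in both columns vanishes, and so do two of the four
  -- terms of its expansion.
  Det-swap : ∀ s k → suc k < s → ∀ M (u v : Vector) →
    Det s (M [ k ≔ u ] [ suc k ≔ v ]) + Det s (M [ k ≔ v ] [ suc k ≔ u ]) ≈ 0#
  Det-swap s k k<s M u v = begin
    P u v + P v u                          ≈⟨ +-cong (+-identityˡ _) (+-identityʳ _) ⟨
    (0# + P u v) + (P v u + 0#)            ≈⟨ +-cong (+-congʳ (equal u)) (+-congˡ (equal v)) ⟨
    (P u u + P u v) + (P v u + P v v)      ≈⟨ +-cong (Det-add s (suc k) k<s _ u v) (Det-add s (suc k) k<s _ u v) ⟨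
    P u (u ⊕ v) + P v (u ⊕ v)              ≈⟨ +-cong (commute u) (commute v) ⟩
    Q u (u ⊕ v) + Q v (u ⊕ v)              ≈⟨ Det-add s k (ℕP.<-trans (ℕP.n<1+n k) k<s) _ u v ⟨
    Q (u ⊕ v) (u ⊕ v)                      ≈⟨ commute (u ⊕ v) ⟨
    P (u ⊕ v) (u ⊕ v)                      ≈⟨ equal (u ⊕ v) ⟩
    0#                                     ∎
    where
    _⊕_ : Vector → Vector → Vector
    (a ⊕ b) r = a r + b r
    P Q : Vector → Vector → Carrier
    P a b = Det s (M [ k ≔ a ] [ suc k ≔ b ])
    Q a b = Det s (M [ suc k ≔ b ] [ k ≔ a ])
    k≢1+k : k ≢ suc k
    k≢1+k = ℕP.<⇒≢ (ℕP.n<1+n k)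
    commute : ∀ a {b} → P a b ≈ Q a b
    commute a {b} = Det-cong s λ c r _ _ → reflexive (≡.cong (λ z → z r) (swapped c))
      where
      swapped : ∀ c → (M [ k ≔ a ] [ suc k ≔ b ]) c ≡ (M [ suc k ≔ b ] [ k ≔ a ]) c
      swapped c with c ≟ suc k | c ≟ k
      ... | yes c≡1+k | yes c≡k = ⊥-elim (k≢1+k (≡.trans (≡.sym c≡k) c≡1+k))
      ... | yes ≡.refl | no _    = ≡.sym (≔-here M (suc k) b)
      ... | no _      | yes ≡.refl = ≔-here M k a
      ... | no c≢1+k  | no c≢k   = ≡.trans (≔-there M k a c≢k) (≡.sym (≔-there M (suc k) b c≢1+k))
    equal : ∀ a → P a a ≈ 0#
    equal a = Det-adjacent s k k<s _ λ r → reflexive (≡.cong (λ z → z r)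
      (≡.trans (≔-there (M [ k ≔ a ]) (suc k) a k≢1+k) (≡.trans (≔-here M k a) (≡.sym (≔-here (M [ k ≔ a ]) (suc k) a)))))

  ≔-self : ∀ M k c → (M [ k ≔ M k ]) c ≡ M c
  ≔-self M k c with c ≟ k
  ... | yes ≡.refl = ≡.refl
  ... | no  _      = ≡.refl

  -- Swapping columns k and k + 1 moves the second copy one place towards the first and changes only
  -- the sign, until the two are adjacent.
  Det-alternating : ∀ s i k → i < k → k < s → ∀ M → (∀ r → M i r ≈ M k r) → Det s M ≈ 0#
  Det-alternating s i (suc k) i<k k<s M eq with i ≟ k
  ... | yes ≡.refl = Det-adjacent s i k<s M eq
  ... | no i≢k = begin
    Det s M                                 ≈⟨ Det-cong s (λ c r _ _ → reflexive (≡.cong (λ z → z r) (≡.sym (restore c)))) ⟩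
    Det s (M [ k ≔ M k ] [ suc k ≔ M (suc k) ])  ≈⟨ +-identityʳ _ ⟨
    Det s (M [ k ≔ M k ] [ suc k ≔ M (suc k) ]) + 0# ≈⟨ +-congˡ vanish ⟨
    Det s (M [ k ≔ M k ] [ suc k ≔ M (suc k) ]) + Det s N ≈⟨ Det-swap s k k<s M (M k) (M (suc k)) ⟩
    0# ∎
    where
    N : Matrix
    N = M [ k ≔ M (suc k) ] [ suc k ≔ M k ]
    i<k′ : i < k
    i<k′ = ℕP.≤∧≢⇒< (ℕP.≤-pred i<k) i≢k
    restore : ∀ c → (M [ k ≔ M k ] [ suc k ≔ M (suc k) ]) c ≡ M c
    restore c with c ≟ suc k
    ... | yes ≡.refl = ≡.refl
    ... | no  _      = ≔-self M k c
    N-i : N i ≡ M i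
    N-i = ≡.trans (≔-there (M [ k ≔ M (suc k) ]) (suc k) (M k) (ℕP.<⇒≢ i<k)) (≔-there M k (M (suc k)) i≢k)
    N-k : N k ≡ M (suc k)
    N-k = ≡.trans (≔-there (M [ k ≔ M (suc k) ]) (suc k) (M k) (ℕP.<⇒≢ (ℕP.n<1+n k))) (≔-here M k (M (suc k)))
    vanish : Det s N ≈ 0#
    vanish = Det-alternating s i k i<k′ (ℕP.<-trans (ℕP.n<1+n k) k<s) N λ r →
      trans (reflexive (≡.cong (λ z → z r) N-i)) (trans (eq r) (sym (reflexive (≡.cong (λ z → z r) N-k))))

  -- The multiples added are of columns of the original `M`, not of columns already changed; this
  -- suits differences of consecutive columns.
  data Sheared (M : Matrix) (p : ℕ) : Vector → Set where
    same : ∀ {v} → (∀ r → v r ≈ M p r) → Sheared M p v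
    add  : ∀ {u v} t i → i < p → Sheared M p u → (∀ r → v r ≈ u r + t * M i r) → Sheared M p v

  Det-shear₁ : ∀ s p → p < s → ∀ M {v} → Sheared M p v → Det s (M [ p ≔ v ]) ≈ Det s M
  Det-shear₁ s p p<s M {v} (same v≈) = Det-cong s λ c r _ _ → entry c r
    where
    entry : ∀ c r → (M [ p ≔ v ]) c r ≈ M c r
    entry c r with c ≟ p
    ... | yes ≡.refl = v≈ r
    ... | no  _      = refl
  Det-shear₁ s p p<s M {v} (add {u} t i i<p sh v≈) = begin
    Det s (M [ p ≔ v ])                            ≈⟨ Det-cong s (λ c r _ _ → entry c r) ⟩
    Det s (M [ p ≔ (λ r → u r + t * M i r) ])      ≈⟨ Det-linear s p p<s M u (M i) t ⟩
    Det s (M [ p ≔ u ]) + t * Det s (M [ p ≔ M i ]) ≈⟨ +-cong (Det-shear₁ s p p<s M sh) (trans (*-congˡ vanish) (zeroʳ t)) ⟩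
    Det s M + 0#                                   ≈⟨ +-identityʳ _ ⟩
    Det s M                                        ∎
    where
    entry : ∀ c r → (M [ p ≔ v ]) c r ≈ (M [ p ≔ (λ r → u r + t * M i r) ]) c r
    entry c r with c ≟ p
    ... | yes _ = v≈ r
    ... | no  _ = refl
    vanish : Det s (M [ p ≔ M i ]) ≈ 0#
    vanish = Det-alternating s i p i<p p<s _ λ r → reflexive (≡.cong (λ z → z r)
      (≡.trans (≔-there M p (M i) (ℕP.<⇒≢ i<p)) (≡.sym (≔-here M p (M i)))))

  mix : Matrix → Matrix → ℕ → Matrix
  mix M N zero    c       = N c
  mix M N (suc p) zero    = M zero
  mix M N (suc p) (suc c) = mix (M ∘ suc) (N ∘ suc) p c

  mix-< : ∀ M N {p c} → c < p → mix M N p c ≡ M c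
  mix-< M N {suc p} {zero}  _         = ≡.refl
  mix-< M N {suc p} {suc c} (s<s c<p) = mix-< (M ∘ suc) (N ∘ suc) c<p

  mix-≥ : ∀ M N {p c} → p ≤ c → mix M N p c ≡ N c
  mix-≥ M N {zero}          _         = ≡.refl
  mix-≥ M N {suc p} {suc c} (s≤s p≤c) = mix-≥ (M ∘ suc) (N ∘ suc) p≤c

  -- The columns of `N` are turned back into those of `M` from left to right. When column p has its
  -- turn, all columns before it are already those of `M`, and these are the ones its shear refers
  -- to.
  Det-shear : ∀ s M N → (∀ p → Sheared M p (N p)) → Det s N ≈ Det s M
  Det-shear s M N sh = trans (up s ℕP.≤-refl) (Det-cong s λ c r c<s _ → reflexive (≡.cong (λ z → z r) (mix-< M N c<s)))
    where
    transport : ∀ p {v} → Sheared M p v → Sheared (mix M N (suc p)) p v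
    transport p (same v≈) = same λ r → trans (v≈ r) (reflexive (≡.cong (λ z → z r) (≡.sym (mix-< M N (ℕP.n<1+n p)))))
    transport p (add t i i<p sh v≈) = add t i i<p (transport p sh)
      λ r → trans (v≈ r) (+-congˡ (*-congˡ (reflexive (≡.cong (λ z → z r) (≡.sym (mix-< M N (ℕP.m<n⇒m<1+n i<p)))))))
    step : ∀ p c → (mix M N (suc p) [ p ≔ N p ]) c ≡ mix M N p c
    step p c with c ≟ p
    ... | yes ≡.refl = ≡.sym (mix-≥ M N (ℕP.≤-refl {c}))
    ... | no c≢p with ℕP.<-cmp c p
    ...   | tri< c<p _ _ = ≡.trans (mix-< M N (ℕP.m<n⇒m<1+n c<p)) (≡.sym (mix-< M N c<p))
    ...   | tri≈ _ c≡p _ = ⊥-elim (c≢p c≡p)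
    ...   | tri> _ _ p<c = ≡.trans (mix-≥ M N p<c) (≡.sym (mix-≥ M N (ℕP.<⇒≤ p<c)))
    up : ∀ p → p ≤ s → Det s N ≈ Det s (mix M N p)
    up zero    _   = refl
    up (suc p) p<s = begin
      Det s N                               ≈⟨ up p (ℕP.<⇒≤ p<s) ⟩
      Det s (mix M N p)                     ≈⟨ Det-cong s (λ c r _ _ → reflexive (≡.cong (λ z → z r) (≡.sym (step p c)))) ⟩
      Det s (mix M N (suc p) [ p ≔ N p ])   ≈⟨ Det-shear₁ s p p<s _ (transport p (sh p)) ⟩
      Det s (mix M N (suc p))               ∎

  Det-zeroRow : ∀ s M → (∀ c → c < suc s → M c s ≈ 0#) → Det (suc s) M ≈ 0#
  Det-zeroRow zero    M row = trans (+-identityʳ _) (trans (*-congˡ (trans (*-congʳ (row 0 z<s)) (zeroˡ _))) (zeroʳ _))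
  Det-zeroRow (suc s) M row = ∑-zero (suc (suc s)) λ j _ → x*y*0≈0 (sgn j) (M j 0)
    (Det-zeroRow s (minor j M) λ c c<s → row (skip j c) (skip-< j c<s))

  -- Induction through the first-row expansion: deleting column 0 leaves a zero last row, and
  -- deleting any other column leaves a smaller matrix of the same shape. The remaining sum is the
  -- expansion of the minor without column 0.
  Det-lastRow : ∀ s M → (∀ c → c < s → M (suc c) s ≈ 0#) →
    Det (suc s) M ≈ sgn s * (M 0 s * Det s (M ∘ suc))
  Det-lastRow zero    M row = +-identityʳ _
  Det-lastRow (suc s) M row = begin
    sgn 0 * (M 0 0 * Det (suc s) (minor 0 M)) + ∑ (suc s) (λ j → sgn (suc j) * (M (suc j) 0 * Det (suc s) (minor (suc j) M)))
      ≈⟨ +-cong (x*y*0≈0 _ _ (Det-zeroRow s (minor 0 M) row)) (∑-cong (suc s) λ j _ → term j) ⟩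
    0# + ∑ (suc s) (λ j → 0# + (- sgn s * M 0 (suc s)) * F j)
      ≈⟨ +-identityˡ _ ⟩
    ∑ (suc s) (λ j → 0# + (- sgn s * M 0 (suc s)) * F j)
      ≈⟨ ∑-linear (suc s) _ (λ _ → 0#) F ⟩
    ∑ (suc s) (λ _ → 0#) + (- sgn s * M 0 (suc s)) * Det (suc s) (M ∘ suc)
      ≈⟨ +-congʳ (∑-zero (suc s) λ _ _ → refl) ⟩
    0# + (- sgn s * M 0 (suc s)) * Det (suc s) (M ∘ suc)
      ≈⟨ +-identityˡ _ ⟩
    (- sgn s * M 0 (suc s)) * Det (suc s) (M ∘ suc)
      ≈⟨ *-assoc _ _ _ ⟩
    - sgn s * (M 0 (suc s) * Det (suc s) (M ∘ suc)) ∎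
    where
    F : ℕ → Carrier
    F j = sgn j * (M (suc j) 0 * Det s (minor j (M ∘ suc)))
    term : ∀ j → sgn (suc j) * (M (suc j) 0 * Det (suc s) (minor (suc j) M)) ≈ 0# + (- sgn s * M 0 (suc s)) * F j
    term j = begin
      - sgn j * (M (suc j) 0 * Det (suc s) (minor (suc j) M))
        ≈⟨ *-congˡ (*-congˡ (Det-lastRow s (minor (suc j) M) λ c c<s → row (skip j c) (skip-< j c<s))) ⟩
      - sgn j * (M (suc j) 0 * (sgn s * (M 0 (suc s) * Det s (minor j (M ∘ suc)))))
        ≈⟨ solve 5 (λ a m b n d → :- a :* (m :* (b :* (n :* d))) := (:- b :* n) :* (a :* (m :* d))) refl _ _ _ _ _ ⟩
      (- sgn s * M 0 (suc s)) * F j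
        ≈⟨ +-identityˡ _ ⟨
      0# + (- sgn s * M 0 (suc s)) * F j ∎

-- Recursive description of the hull lengths.

module PathDistances where
  open import Data.Bool using (Bool; true; false; not)
  open import Data.Nat using (ℕ; zero; suc; _+_; _*_)
  import Data.Nat.Properties as ℕP
  open import Relation.Binary.PropositionalEquality using (_≡_; refl; sym; trans; cong)

  twice : ℕ → ℕ
  twice zero    = zero
  twice (suc h) = suc (suc (twice h))

  twice≡2* : ∀ h → twice h ≡ 2 * h
  twice≡2* zero    = refl
  twice≡2* (suc h) = cong suc (trans (cong suc (twice≡2* h)) (sym (ℕP.+-suc h (h + 0))))

  parity base : Bool → ℕ
  parity true  = 1
  parity false = 0
  base true  = 1
  base false = 2

  tally : Bool → ℕ → ℕ
  tally b zero    = 0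
  tally b (suc r) = parity b + tally (not b) r

  parityAt : Bool → ℕ → ℕ
  parityAt b zero    = parity b
  parityAt b (suc c) = parityAt (not b) c

  above : ℕ → ℕ → ℕ
  above zero    c       = 0
  above (suc r) zero    = 1
  above (suc r) (suc c) = above r c

  -- The distance of the entries numbered r and c in the list e, f, e, f, …
  -- (b = true) or f, e, f, e, … (b = false).
  dist : Bool → ℕ → ℕ → ℕ
  dist b zero    c       = base b + tally b c
  dist b (suc r) zero    = base b + tally b (suc r)
  dist b (suc r) (suc c) = dist (not b) r c

  tally-suc : ∀ b c → tally b (suc c) ≡ tally b c + parityAt b c
  tally-suc b zero    = ℕP.+-comm (parity b) 0
  tally-suc b (suc c) = trans (cong (parity b +_) (tally-suc (not b) c))
    (sym (ℕP.+-assoc (parity b) _ _))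

  -- From entry c to entry c + 1 the interval moves its right end if the parity is 1 and its left
  -- end if it is 0. For r ≤ c the hull ends where the column's interval ends, so it grows by the
  -- parity; for r > c it begins where that interval begins, so it shrinks by one minus the parity.
  dist-suc : ∀ b r c → dist b r (suc c) + above r c ≡ dist b r c + parityAt b c
  dist-suc b     zero    c       = trans (ℕP.+-identityʳ _) (trans (cong (base b +_) (tally-suc b c))
    (sym (ℕP.+-assoc (base b) _ _)))
  dist-suc true  (suc zero)    zero = refl
  dist-suc true  (suc (suc r)) zero = refl
  dist-suc false (suc zero)    zero = refl
  dist-suc false (suc (suc r)) zero = cong (2 +_) (ℕP.+-suc (tally false r) 0)
  dist-suc b     (suc r) (suc c) = dist-suc (not b) r c

-- From the determinant to linear recurrences.

module Transfer
  (R : CommutativeRing 0ℓ 0ℓ)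
  (ℤ⟶R : CommutativeRing.rawRing ℤP.+-*-commutativeRing -Raw-AlmostCommutative⟶ fromCommutativeRing R)
  (x : CommutativeRing.Carrier R)
  where

  open import Data.Bool using (Bool; true; false; not)
  open import Data.Integer using (+_)
  open import Data.Nat using (ℕ; zero; suc; _<_; z<s; s<s)
  import Data.Nat as ℕ
  import Data.Nat.Properties as ℕP
  open import Data.Product using (_×_; _,_; proj₁; proj₂)
  open import Function using (_∘_)
  open import Relation.Binary.PropositionalEquality as ≡ using (_≡_)

  open CommutativeRing R hiding (zero)
  open _-Raw-AlmostCommutative⟶_ ℤ⟶R renaming (⟦_⟧ to ι)
  open import Relation.Binary.Reasoning.Setoid setoid
  open Determinants R ℤ⟶R
  open PathDistances

  κ : ℕ → Carrier
  κ n = ι (+ n)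

  :κ : ∀ {n} → ℕ → Polynomial n
  :κ k = con (+ k)

  κ-+ : ∀ m n → κ (m ℕ.+ n) ≈ κ m + κ n
  κ-+ m n = +-homo (+ m) (+ n)

  diagonal : ℕ → ℕ → Carrier
  diagonal zero    zero    = x
  diagonal zero    (suc c) = κ 0
  diagonal (suc r) zero    = κ 0
  diagonal (suc r) (suc c) = diagonal r c

  -- Row s is the border row. It obeys a rule of its own and stays last when rows are deleted from
  -- the top.
  extend : ℕ → Vector → Carrier → Vector
  extend zero    f d r       = d
  extend (suc s) f d zero    = f 0
  extend (suc s) f d (suc r) = extend s (f ∘ suc) d r

  extend-cong : ∀ s {f g : Vector} {d} → (∀ r → f r ≈ g r) → ∀ r → extend s f d r ≈ extend s g d r
  extend-cong zero    f≈g r       = refl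
  extend-cong (suc s) f≈g zero    = f≈g 0
  extend-cong (suc s) f≈g (suc r) = extend-cong s (f≈g ∘ suc) r

  extend-linear : ∀ s {f g h : Vector} {d e k} t → (∀ r → f r ≈ g r + t * h r) → d ≈ e + t * k →
    ∀ r → extend s f d r ≈ extend s g e r + t * extend s h k r
  extend-linear zero    t f≈ d≈ r       = d≈
  extend-linear (suc s) t f≈ d≈ zero    = f≈ 0
  extend-linear (suc s) t f≈ d≈ (suc r) = extend-linear s t (f≈ ∘ suc) d≈ r

  extend-last : ∀ s {f : Vector} {d} → extend s f d s ≡ d
  extend-last zero    = ≡.refl
  extend-last (suc s) = extend-last s

  extend-< : ∀ {s} {f : Vector} {d r} → r < s → extend s f d r ≡ f r
  extend-< {suc s} {r = zero}  _         = ≡.refl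
  extend-< {suc s} {r = suc r} (s<s r<s) = extend-< {s} r<s

  -- Coordinates of a front column with respect to the first unit vector, the
  -- all-ones vector, the vector tally b (these two off the last row) and the
  -- last unit vector.
  record Front : Set where
    constructor front
    field unit ones tall last : Carrier

  open Front

  body : Bool → Front → Vector
  body b p zero    = unit p + ones p
  body b p (suc r) = ones p + tall p * κ (tally b (suc r))

  frontColumn : ℕ → Bool → Front → Vector
  frontColumn s b p = extend s (body b p) (last p)

  tailBody : ℕ → Vector
  tailBody c r = (diagonal r (suc c) - diagonal r c) + κ (above r c)

  tailColumn : ℕ → Bool → ℕ → Vector
  tailColumn s b c = extend s (tailBody c) (κ (parityAt b c))

  frame : ℕ → Bool → Front → Front → Matrix
  frame s b p q zero          = frontColumn s b p
  frame s b p q (suc zero)    = frontColumn s b q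
  frame s b p q (suc (suc c)) = tailColumn s b c

  -- Deleting row 0 kills the first unit vector, and since `tally b (suc r)` is
  -- `parity b + tally (not b) r`, the tally vector passes part of itself to the ones vector.
  shift : Bool → Front → Front
  shift b p = front (κ 0) (ones p + tall p * κ (parity b)) (tall p) (last p)

  -- The first tail column below row 0: x + 1, then ones, then the parity in the border row.
  newFront : Bool → Front
  newFront b = front x (κ 1) (κ 0) (κ (parity b))

  frontColumn-shift : ∀ s b p r → frontColumn (suc s) b p (suc r) ≈ frontColumn s (not b) (shift b p) r
  frontColumn-shift s b p = extend-cong s go
    where
    go : ∀ r → body b p (suc r) ≈ body (not b) (shift b p) r
    go zero    = trans (+-congˡ (*-congˡ (κ-+ (parity b) 0)))
      (solve 3 (λ o t π → o :+ t :* (π :+ :κ 0) := :κ 0 :+ (o :+ t :* π)) refl _ _ _)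
    go (suc r) = trans (+-congˡ (*-congˡ (κ-+ (parity b) _)))
      (solve 4 (λ o t π T → o :+ t :* (π :+ T) := (o :+ t :* π) :+ t :* T) refl _ _ _ _)

  tailColumn-shift : ∀ s b r → tailColumn (suc s) b 0 (suc r) ≈ frontColumn s (not b) (newFront b) r
  tailColumn-shift s b = extend-cong s go
    where
    go : ∀ r → tailBody 0 (suc r) ≈ body (not b) (newFront b) r
    go zero    = solve 1 (λ x → (x :- :κ 0) :+ :κ 1 := x :+ :κ 1) refl _
    go (suc r) = solve 1 (λ T → (:κ 0 :- :κ 0) :+ :κ 1 := :κ 1 :+ :κ 0 :* T) refl _

  -- Up to sign, the determinants of the frames whose front columns are two of
  -- the four basis vectors: A (unit, last), B (ones, last), x G (tall, last),
  -- G (unit, ones), K (unit, tall), J (ones, tall).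
  seqA seqB : ℕ → Carrier
  seqA zero    = κ 1
  seqA (suc l) = x * seqA l + seqB l
  seqB zero    = κ 1
  seqB (suc l) = seqA (suc l) + x * seqB l

  seqG seqJ seqK : Bool → ℕ → Carrier
  seqG b zero    = κ 0
  seqG b (suc l) = x * seqG (not b) l + κ (parity b) * seqB l
  seqK b zero    = κ 0
  seqK b (suc l) = (x * seqK (not b) l + seqJ (not b) l) + κ (parity b) * (κ 2 * (x * seqG (not b) l) + seqB l)
  seqJ b zero    = κ 0
  seqJ b (suc l) = seqK b (suc l) + x * seqJ (not b) l

  -- A determinant is bilinear and alternating in its two front columns, so it depends on them only
  -- through the six 2×2 minors (Plücker coordinates) of their coordinates. The six weights need
  -- only five values, because the one of (tall, last) is x G.
  wedge : (A B G J K : Carrier) → Front → Front → Carrier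
  wedge A B G J K (front u o t l) (front u′ o′ t′ l′) =
    (u * l′ - l * u′) * A + (o * l′ - l * o′) * B + (t * l′ - l * t′) * (x * G)
    - (u * o′ - o * u′) * G - (u * t′ - t * u′) * K - (o * t′ - t * o′) * J

  Wedge : ℕ → Bool → Front → Front → Carrier
  Wedge l b = wedge (seqA l) (seqB l) (seqG b l) (seqJ b l) (seqK b l)

  :wedge : ∀ {n} (x A B G J K u o t l u′ o′ t′ l′ : Polynomial n) → Polynomial n
  :wedge x A B G J K u o t l u′ o′ t′ l′ =
    (u :* l′ :- l :* u′) :* A :+ (o :* l′ :- l :* o′) :* B :+ (t :* l′ :- l :* t′) :* (x :* G)
    :- (u :* o′ :- o :* u′) :* G :- (u :* t′ :- t :* u′) :* K :- (o :* t′ :- t :* o′) :* J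

  -- The three summands are the expansion along row 0, whose entries are those of the two fronts and
  -- the -x of the first tail column. Comparing the six coordinates on both sides is how the
  -- recurrences of the five sequences arise.
  wedge-step : ∀ A B G J K b p q →
    let π = κ (parity b) ; A′ = x * A + B ; K′ = (x * K + J) + π * (κ 2 * (x * G) + B) in
    (unit p + ones p) * wedge A B G J K (shift b q) (newFront b)
    + - ((unit q + ones q) * wedge A B G J K (shift b p) (newFront b))
    + - x * wedge A B G J K (shift b p) (shift b q)
    ≈ - wedge A′ (A′ + x * B) (x * G + π * B) (K′ + x * J) K′ p q
  wedge-step A B G J K b (front u o t l) (front u′ o′ t′ l′) = byParity b
    where
    equation : ∀ {n} → ℕ → (x A B G J K u o t l u′ o′ t′ l′ : Polynomial n) → Polynomial n × Polynomial n
    equation k x A B G J K u o t l u′ o′ t′ l′ =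
      (u :+ o) :* :wedge x A B G J K (:κ 0) (o′ :+ t′ :* π) t′ l′ x (:κ 1) (:κ 0) π
      :+ :- ((u′ :+ o′) :* :wedge x A B G J K (:κ 0) (o :+ t :* π) t l x (:κ 1) (:κ 0) π)
      :+ :- x :* :wedge x A B G J K (:κ 0) (o :+ t :* π) t l (:κ 0) (o′ :+ t′ :* π) t′ l′
      := :- :wedge x A₁ (A₁ :+ x :* B) (x :* G :+ π :* B) (K₁ :+ x :* J) K₁ u o t l u′ o′ t′ l′
      where
      π  = :κ k
      A₁ = x :* A :+ B
      K₁ = (x :* K :+ J) :+ π :* (:κ 2 :* (x :* G) :+ B)
    byParity : ∀ b →
      let p = front u o t l ; q = front u′ o′ t′ l′
          π = κ (parity b) ; A′ = x * A + B ; K′ = (x * K + J) + π * (κ 2 * (x * G) + B) in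
      (u + o) * wedge A B G J K (shift b q) (newFront b)
      + - ((u′ + o′) * wedge A B G J K (shift b p) (newFront b))
      + - x * wedge A B G J K (shift b p) (shift b q)
      ≈ - wedge A′ (A′ + x * B) (x * G + π * B) (K′ + x * J) K′ p q
    -- The identity uses π² = π, so it is not one between polynomials in π and is checked at both
    -- values.
    byParity true  = solve 14 (equation 1) refl x A B G J K u o t l u′ o′ t′ l′
    byParity false = solve 14 (equation 0) refl x A B G J K u o t l u′ o′ t′ l′

  Det-1×1 : ∀ M → Det 1 M ≈ M 0 0
  Det-1×1 M = trans (+-identityʳ _) (trans (*-identityˡ _) (*-identityʳ _))

  -- Row 0 meets only the two front columns and the first tail column, and
  -- deleting any of these three leaves a frame again.
  Det-frame : ∀ l b p q → Det (suc (suc l)) (frame (suc l) b p q) ≈ sgn l * Wedge l b p q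
  Det-frame zero b p q = begin
    1# * ((unit p + ones p) * Det 1 (minor 0 M)) + (- 1# * ((unit q + ones q) * Det 1 (minor 1 M)) + 0#)
      ≈⟨ +-cong (*-congˡ (*-congˡ (Det-1×1 (minor 0 M)))) (trans (+-identityʳ _) (*-congˡ (*-congˡ (Det-1×1 (minor 1 M))))) ⟩
    1# * ((unit p + ones p) * last q) + - 1# * ((unit q + ones q) * last p)
      ≈⟨ solve 10 (λ i x u o t l u′ o′ t′ l′ → i :* ((u :+ o) :* l′) :+ :- i :* ((u′ :+ o′) :* l)
           := i :* :wedge x (:κ 1) (:κ 1) (:κ 0) (:κ 0) (:κ 0) u o t l u′ o′ t′ l′)
           refl 1# x (unit p) (ones p) (tall p) (last p) (unit q) (ones q) (tall q) (last q) ⟩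
    1# * Wedge 0 b p q ∎
    where M = frame 1 b p q
  Det-frame (suc l) b p q = begin
    1# * ((unit p + ones p) * D 0) + (- 1# * ((unit q + ones q) * D 1) + (- - 1# * (M 2 0 * D 2) + ∑ l _))
      ≈⟨ +-cong (*-congˡ (*-congˡ minor₀)) (+-cong (*-congˡ (*-congˡ minor₁))
           (+-cong (*-congˡ (*-congˡ minor₂)) (∑-zero l λ j _ → far j))) ⟩
    1# * ((unit p + ones p) * (sgn l * W₀))
    + (- 1# * ((unit q + ones q) * (sgn l * W₁)) + (- - 1# * (M 2 0 * (sgn l * W₂)) + 0#))
      ≈⟨ +-cong (*-identityˡ _) (+-congˡ (+-identityʳ _)) ⟩
    (unit p + ones p) * (sgn l * W₀) + (- 1# * ((unit q + ones q) * (sgn l * W₁)) + (- - 1# * (M 2 0 * (sgn l * W₂))))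
      -- The signs become images of integers, which the solver can treat as constants.
      ≈⟨ +-congˡ (+-cong (*-congʳ (-‿cong 1-homo)) (*-congʳ (-‿cong (-‿cong 1-homo)))) ⟨
    (unit p + ones p) * (sgn l * W₀) + (- κ 1 * ((unit q + ones q) * (sgn l * W₁)) + (- - κ 1 * (M 2 0 * (sgn l * W₂))))
      ≈⟨ solve 7 (λ σ v w x W₀ W₁ W₂ →
           v :* (σ :* W₀) :+ (:- :κ 1 :* (w :* (σ :* W₁)) :+ :- :- :κ 1 :* (((:κ 0 :- x) :+ :κ 0) :* (σ :* W₂)))
           := σ :* (v :* W₀ :+ :- (w :* W₁) :+ :- x :* W₂)) refl (sgn l) (unit p + ones p) (unit q + ones q) x W₀ W₁ W₂ ⟩
    sgn l * ((unit p + ones p) * W₀ + - ((unit q + ones q) * W₁) + - x * W₂)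
      ≈⟨ *-congˡ (wedge-step _ _ _ _ _ b p q) ⟩
    sgn l * - Wedge (suc l) b p q
      ≈⟨ solve 2 (λ σ W → σ :* :- W := :- σ :* W) refl _ _ ⟩
    - sgn l * Wedge (suc l) b p q ∎
    where
    M = frame (suc (suc l)) b p q
    D = λ j → Det (suc (suc l)) (minor j M)
    W₀ = Wedge l (not b) (shift b q) (newFront b)
    W₁ = Wedge l (not b) (shift b p) (newFront b)
    W₂ = Wedge l (not b) (shift b p) (shift b q)
    minor₀ : D 0 ≈ sgn l * W₀
    minor₀ = trans (Det-cong (suc (suc l)) {minor 0 M} {frame (suc l) (not b) (shift b q) (newFront b)} λ
        { zero          r _ _ → frontColumn-shift (suc l) b q r
        ; (suc zero)    r _ _ → tailColumn-shift (suc l) b r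
        ; (suc (suc c)) r _ _ → refl })
      (Det-frame l (not b) (shift b q) (newFront b))
    minor₁ : D 1 ≈ sgn l * W₁
    minor₁ = trans (Det-cong (suc (suc l)) {minor 1 M} {frame (suc l) (not b) (shift b p) (newFront b)} λ
        { zero          r _ _ → frontColumn-shift (suc l) b p r
        ; (suc zero)    r _ _ → tailColumn-shift (suc l) b r
        ; (suc (suc c)) r _ _ → refl })
      (Det-frame l (not b) (shift b p) (newFront b))
    minor₂ : D 2 ≈ sgn l * W₂
    minor₂ = trans (Det-cong (suc (suc l)) {minor 2 M} {frame (suc l) (not b) (shift b p) (shift b q)} λ
        { zero          r _ _ → frontColumn-shift (suc l) b p r
        ; (suc zero)    r _ _ → frontColumn-shift (suc l) b q r
        ; (suc (suc c)) r _ _ → refl })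
      (Det-frame l (not b) (shift b p) (shift b q))
    far : ∀ j → sgn (suc (suc (suc j))) * (M (suc (suc (suc j))) 0 * D (suc (suc (suc j)))) ≈ 0#
    far j = trans (solve 2 (λ σ d → σ :* (((:κ 0 :- :κ 0) :+ :κ 0) :* d) := :κ 0) refl _ _) 0-homo

  entry : Bool → Matrix
  entry b c r = diagonal r c - κ (dist b r c)

  -- The border row is zero except in the ones column, so up to sign the determinant stays that of
  -- `entry`, while multiples of the ones column may now be added to the others.
  bordered : ℕ → Bool → Matrix
  bordered s b zero    = extend s (λ _ → κ 1) (κ 1)
  bordered s b (suc c) = extend s (entry b c) (κ 0)

  -- The second is the first column of xI - 𝔇: its distances are 1 plus the tally, and its border
  -- entry is 0.
  onesFront firstFront : Front
  onesFront  = front (κ 0) (κ 1) (κ 0) (κ 1)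
  firstFront = front x (- κ 1) (- κ 1) (κ 0)

  -- A later column becomes itself minus its predecessor plus the parity times the ones column. By
  -- `dist-suc` the distances then contribute 0 on and above the diagonal and 1 below it, and the
  -- border row records the parity that was added.
  bordered-sheared : ∀ s p → Sheared (bordered s true) p (frame s true onesFront firstFront p)
  bordered-sheared s zero = same (extend-cong s go)
    where
    go : ∀ r → body true onesFront r ≈ κ 1
    go zero    = solve 0 (:κ 0 :+ :κ 1 := :κ 1) refl
    go (suc r) = solve 1 (λ T → :κ 1 :+ :κ 0 :* T := :κ 1) refl _
  bordered-sheared s (suc zero) = same (extend-cong s go)
    where
    go : ∀ r → body true firstFront r ≈ entry true 0 r
    go zero    = refl
    go (suc r) = trans (solve 1 (λ T → :- :κ 1 :+ :- :κ 1 :* T := :κ 0 :- (:κ 1 :+ T)) refl _)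
      (+-congˡ (-‿cong (sym (κ-+ 1 (tally true (suc r))))))
  bordered-sheared s (suc (suc c)) =
    add (κ π) 0 z<s
      (add {v = extend s (λ r → entry true (suc c) r + - κ 1 * entry true c r) (κ 0)}
        (- κ 1) (suc c) (ℕP.n<1+n (suc c)) (same λ _ → refl)
        (extend-linear s (- κ 1) (λ _ → refl) (solve 0 (:κ 0 := :κ 0 :+ :- :κ 1 :* :κ 0) refl)))
      (extend-linear s (κ π) go (solve 1 (λ π → π := :κ 0 :+ π :* :κ 1) refl (κ π)))
    where
    π = parityAt true c
    go : ∀ r → tailBody c r ≈ (entry true (suc c) r + - κ 1 * entry true c r) + κ π * κ 1
    go r = begin
      (X′ - X) + κ (above r c)
        ≈⟨ solve 4 (λ X′ X a D → (X′ :- X) :+ a := (X′ :- X) :+ ((D :+ a) :- D)) refl X′ X (κ (above r c)) (κ d′) ⟩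
      (X′ - X) + ((κ d′ + κ (above r c)) - κ d′)
        ≈⟨ +-congˡ (+-congʳ (trans (sym (κ-+ d′ (above r c))) (trans (reflexive (≡.cong κ (dist-suc true r c))) (κ-+ d π)))) ⟩
      (X′ - X) + ((κ d + κ π) - κ d′)
        ≈⟨ solve 5 (λ X′ X D D′ P → (X′ :- X) :+ ((D :+ P) :- D′)
             := ((X′ :- D′) :+ :- :κ 1 :* (X :- D)) :+ P :* :κ 1) refl X′ X (κ d) (κ d′) (κ π) ⟩
      ((X′ - κ d′) + - κ 1 * (X - κ d)) + κ π * κ 1 ∎
      where
      X′ = diagonal r (suc c)
      X = diagonal r c
      d′ = dist true r (suc c)
      d = dist true r c

  seqP : ℕ → Carrier
  seqP l = x * seqA l - seqB l - κ 2 * (x * seqG true l) - seqJ true l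

  sgn² : ∀ l → sgn l * sgn l ≈ κ 1
  sgn² zero    = trans (*-identityˡ 1#) (sym 1-homo)
  sgn² (suc l) = trans (solve 1 (λ s → :- s :* :- s := s :* s) refl (sgn l)) (sgn² l)

  Det-entry : ∀ l → Det (suc l) (entry true) ≈ seqP l
  Det-entry l = begin
    Det m (entry true)
      ≈⟨ Det-cong m (λ c r _ r<m → reflexive (≡.sym (extend-< {m} {entry true c} {κ 0} r<m))) ⟩
    Det m (bordered m true ∘ suc)
      ≈⟨ D≈ ⟩
    seqP l ∎
    where
    m = suc l
    d = Det m (bordered m true ∘ suc)
    key : sgn m * d ≈ sgn l * Wedge l true onesFront firstFront
    key = begin
      sgn m * d
        ≈⟨ *-congˡ (trans (*-congʳ (trans (reflexive (extend-last m {λ _ → κ 1})) 1-homo)) (*-identityˡ d)) ⟨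
      sgn m * (bordered m true 0 m * d)
        ≈⟨ Det-lastRow m (bordered m true) (λ c _ → trans (reflexive (extend-last m {entry true c})) 0-homo) ⟨
      Det (suc m) (bordered m true)
        ≈⟨ Det-shear (suc m) (bordered m true) (frame m true onesFront firstFront) (bordered-sheared m) ⟨
      Det (suc m) (frame m true onesFront firstFront)
        ≈⟨ Det-frame l true onesFront firstFront ⟩
      sgn l * Wedge l true onesFront firstFront ∎
    -- As `sgn m` is `- sgn l`, multiplying `key` by `- sgn l` isolates d.
    D≈ : d ≈ seqP l
    D≈ = begin
      d                                        ≈⟨ solve 1 (λ d → d := :κ 1 :* d) refl d ⟩
      κ 1 * d                                  ≈⟨ *-congʳ (sgn² l) ⟨
      (sgn l * sgn l) * d                      ≈⟨ solve 2 (λ s d → (s :* s) :* d := :- (s :* (:- s :* d))) refl (sgn l) d ⟩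
      - (sgn l * (sgn m * d))                  ≈⟨ -‿cong (*-congˡ key) ⟩
      - (sgn l * (sgn l * Wedge l true onesFront firstFront)) ≈⟨ -‿cong (sym (*-assoc _ _ _)) ⟩
      - ((sgn l * sgn l) * Wedge l true onesFront firstFront) ≈⟨ -‿cong (*-congʳ (sgn² l)) ⟩
      - (κ 1 * Wedge l true onesFront firstFront)
        ≈⟨ solve 6 (λ x A B G J K →
             :- (:κ 1 :* :wedge x A B G J K (:κ 0) (:κ 1) (:κ 0) (:κ 1) x (:- :κ 1) (:- :κ 1) (:κ 0))
             := x :* A :- B :- :κ 2 :* (x :* G) :- J)
             refl x (seqA l) (seqB l) (seqG true l) (seqJ true l) (seqK true l) ⟩
      seqP l ∎

  -- Closed forms of the recurrences at even levels.

  evenPower : ℕ → Carrier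
  evenPower zero    = κ 1
  evenPower (suc h) = x * (x * evenPower h)

  -- The recurrences alternate with the parity of the level; multiplication by
  -- w makes their solutions combinations of A, B and powers of x.
  w v : Carrier
  w = κ 4 * x + κ 1
  v = κ 2 * x + κ 1

  -- Numerators of G over w and of J and K over w², with η for h and X for x^2h.
  wG wwJ wwK : (η A B X : Carrier) → Carrier
  wG  η A B X = B + κ 2 * (x * A) - v * X
  wwJ η A B X = (x + η * (v * w)) * B + κ 4 * (x * x) * (v * X) - x * ((κ 8 * x + κ 4) * x + κ 1) * A
  wwK η A B X =
    ((κ 8 * x + κ 5) * x + κ 1 + η * (v * w)) * A - ((κ 4 * x + κ 3) * x + κ 1) * B - κ 2 * (x * (v * X))

  module _ {n} (x : Polynomial n) where
    :w :v : Polynomial n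
    :w = :κ 4 :* x :+ :κ 1
    :v = :κ 2 :* x :+ :κ 1

    :wG :wwJ :wwK : (η A B X : Polynomial n) → Polynomial n
    :wG  η A B X = B :+ :κ 2 :* (x :* A) :- :v :* X
    :wwJ η A B X =
      (x :+ η :* (:v :* :w)) :* B :+ :κ 4 :* (x :* x) :* (:v :* X) :- x :* ((:κ 8 :* x :+ :κ 4) :* x :+ :κ 1) :* A
    :wwK η A B X =
      ((:κ 8 :* x :+ :κ 5) :* x :+ :κ 1 :+ η :* (:v :* :w)) :* A :- ((:κ 4 :* x :+ :κ 3) :* x :+ :κ 1) :* B
      :- :κ 2 :* (x :* (:v :* X))

    :B₁ :A₂ :B₂ : (A B : Polynomial n) → Polynomial n
    :B₁ A B = (x :* A :+ B) :+ x :* B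
    :A₂ A B = x :* (x :* A :+ B) :+ :B₁ A B
    :B₂ A B = :A₂ A B :+ x :* :B₁ A B

  wG-closed : ∀ h → let l = twice h in w * seqG true l ≈ wG (κ h) (seqA l) (seqB l) (evenPower h)
  wG-closed zero    = solve 1 (λ x → :w x :* :κ 0 := :wG x (:κ 0) (:κ 1) (:κ 1) (:κ 1)) refl x
  wG-closed (suc h) = begin
    w * seqG true (twice (suc h))
      ≈⟨ solve 5 (λ x w B B₁ G → w :* (x :* (x :* G :+ :κ 0 :* B) :+ :κ 1 :* B₁) := (x :* x) :* (w :* G) :+ w :* B₁)
           refl x w B (seqB (suc l)) (seqG true l) ⟩
    (x * x) * (w * seqG true l) + w * seqB (suc l)
      ≈⟨ +-congʳ (*-congˡ (wG-closed h)) ⟩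
    (x * x) * wG (κ h) A B X + w * seqB (suc l)
      ≈⟨ solve 5 (λ x η A B X → (x :* x) :* :wG x η A B X :+ :w x :* :B₁ x A B
           := :wG x η (:A₂ x A B) (:B₂ x A B) (x :* (x :* X))) refl x (κ h) A B X ⟩
    wG (κ (suc h)) (seqA (twice (suc h))) (seqB (twice (suc h))) (evenPower (suc h)) ∎
    where
    l = twice h
    A = seqA l
    B = seqB l
    X = evenPower h

  -- J and K feed each other, so both formulas go through one induction, two levels at a time.
  ww-closed : ∀ h → let l = twice h in
    (w * (w * seqJ true l) ≈ wwJ (κ h) (seqA l) (seqB l) (evenPower h)) ×
    (w * (w * seqK true l) ≈ wwK (κ h) (seqA l) (seqB l) (evenPower h))
  ww-closed zero =
    solve 1 (λ x → :w x :* (:w x :* :κ 0) := :wwJ x (:κ 0) (:κ 1) (:κ 1) (:κ 1)) refl x ,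
    solve 1 (λ x → :w x :* (:w x :* :κ 0) := :wwK x (:κ 0) (:κ 1) (:κ 1) (:κ 1)) refl x
  ww-closed (suc h) = stepJ , stepK
    where
    l = twice h
    A = seqA l
    B = seqB l
    G = seqG true l
    J = seqJ true l
    K = seqK true l
    X = evenPower h
    B₁ = seqB (suc l)
    A₂ = seqA (suc (suc l))
    B₂ = seqB (suc (suc l))
    X₂ = evenPower (suc h)
    -- Over two levels J and K each become a combination of the old K and J plus the same forcing
    -- 2x²G + B₁; the inner level has parity 0 and forces nothing.
    combine : ∀ c d →
      c * (w * (w * K)) + d * (w * (w * J)) + κ 2 * (x * x) * (w * (w * G)) + w * (w * B₁)
      ≈ c * wwK (κ h) A B X + d * wwJ (κ h) A B X + κ 2 * (x * x) * (w * wG (κ h) A B X) + w * (w * B₁)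
    combine c d = +-congʳ (+-cong (+-cong (*-congˡ (proj₂ (ww-closed h))) (*-congˡ (proj₁ (ww-closed h))))
      (*-congˡ (*-congˡ (wG-closed h))))
    :next : ∀ {n} (x c d η A B X : Polynomial n) → Polynomial n
    :next x c d η A B X = c :* :wwK x η A B X :+ d :* :wwJ x η A B X
      :+ :κ 2 :* (x :* x) :* (:w x :* :wG x η A B X) :+ :w x :* (:w x :* :B₁ x A B)
    stepJ : w * (w * seqJ true (suc (suc l))) ≈ wwJ (κ (suc h)) A₂ B₂ X₂
    stepJ = begin
      w * (w * seqJ true (suc (suc l)))
        ≈⟨ solve 7 (λ x w B B₁ G J K →
             let G₁ = x :* G :+ :κ 0 :* B
                 K₁ = (x :* K :+ J) :+ :κ 0 :* (:κ 2 :* (x :* G) :+ B)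
                 J₁ = K₁ :+ x :* J
                 K₂ = (x :* K₁ :+ J₁) :+ :κ 1 :* (:κ 2 :* (x :* G₁) :+ B₁)
             in w :* (w :* (K₂ :+ x :* J₁))
               := (x :* x :+ (:κ 1 :+ x) :* x) :* (w :* (w :* K)) :+ (x :+ (:κ 1 :+ x) :* (:κ 1 :+ x)) :* (w :* (w :* J))
                  :+ :κ 2 :* (x :* x) :* (w :* (w :* G)) :+ w :* (w :* B₁)) refl x w B B₁ G J K ⟩
      (x * x + (κ 1 + x) * x) * (w * (w * K)) + (x + (κ 1 + x) * (κ 1 + x)) * (w * (w * J))
        + κ 2 * (x * x) * (w * (w * G)) + w * (w * B₁)
        ≈⟨ combine (x * x + (κ 1 + x) * x) (x + (κ 1 + x) * (κ 1 + x)) ⟩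
      _
        ≈⟨ solve 5 (λ x η A B X →
             :next x (x :* x :+ (:κ 1 :+ x) :* x) (x :+ (:κ 1 :+ x) :* (:κ 1 :+ x)) η A B X
             := :wwJ x (:κ 1 :+ η) (:A₂ x A B) (:B₂ x A B) (x :* (x :* X))) refl x (κ h) A B X ⟩
      wwJ (κ 1 + κ h) A₂ B₂ X₂
        ≈⟨ +-congʳ (+-congʳ (*-congʳ (+-congˡ (*-congʳ (κ-+ 1 h))))) ⟨
      wwJ (κ (suc h)) A₂ B₂ X₂ ∎
    stepK : w * (w * seqK true (suc (suc l))) ≈ wwK (κ (suc h)) A₂ B₂ X₂
    stepK = begin
      w * (w * seqK true (suc (suc l)))
        ≈⟨ solve 7 (λ x w B B₁ G J K →
             let G₁ = x :* G :+ :κ 0 :* B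
                 K₁ = (x :* K :+ J) :+ :κ 0 :* (:κ 2 :* (x :* G) :+ B)
                 J₁ = K₁ :+ x :* J
             in w :* (w :* ((x :* K₁ :+ J₁) :+ :κ 1 :* (:κ 2 :* (x :* G₁) :+ B₁)))
               := (x :* x :+ x) :* (w :* (w :* K)) :+ (x :+ (:κ 1 :+ x)) :* (w :* (w :* J))
                  :+ :κ 2 :* (x :* x) :* (w :* (w :* G)) :+ w :* (w :* B₁)) refl x w B B₁ G J K ⟩
      (x * x + x) * (w * (w * K)) + (x + (κ 1 + x)) * (w * (w * J)) + κ 2 * (x * x) * (w * (w * G)) + w * (w * B₁)
        ≈⟨ combine (x * x + x) (x + (κ 1 + x)) ⟩
      _
        ≈⟨ solve 5 (λ x η A B X → :next x (x :* x :+ x) (x :+ (:κ 1 :+ x)) η A B X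
             := :wwK x (:κ 1 :+ η) (:A₂ x A B) (:B₂ x A B) (x :* (x :* X))) refl x (κ h) A B X ⟩
      wwK (κ 1 + κ h) A₂ B₂ X₂
        ≈⟨ +-congʳ (+-congʳ (*-congʳ (+-congˡ (*-congʳ (κ-+ 1 h))))) ⟨
      wwK (κ (suc h)) A₂ B₂ X₂ ∎

  defect : ℕ → Carrier
  defect h = x * evenPower h - seqP (twice h)

  -- Negative terms stand on the opposite side, so apart from those of `U` only natural coefficients
  -- occur when this is read off degree by degree.
  defect-closed : ∀ h → let U = defect h ; A = seqA (twice h) ; B = seqB (twice h) ; X = evenPower h in
    κ 16 * (x * (x * U)) + κ 8 * (x * U) + U
    + (κ 8 * (x * (x * (x * A))) + κ 8 * (x * (x * A)) + κ 2 * (x * A)) + x * X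
    ≈ κ 8 * (x * (x * (x * X)))
    + (κ (24 ℕ.+ 8 ℕ.* h) * (x * (x * B)) + κ (11 ℕ.+ 6 ℕ.* h) * (x * B) + κ (1 ℕ.+ h) * B)
  defect-closed h = begin
    κ 16 * (x * (x * U)) + κ 8 * (x * U) + U + low + x * X
      ≈⟨ solve 7 (λ x A B G J X low →
           let U = x :* X :- (x :* A :- B :- :κ 2 :* (x :* G) :- J)
           in :κ 16 :* (x :* (x :* U)) :+ :κ 8 :* (x :* U) :+ U :+ low :+ x :* X
              := :w x :* (:w x :* (x :* X :- x :* A :+ B)) :+ :κ 2 :* x :* (:w x :* (:w x :* G)) :+ :w x :* (:w x :* J)
                 :+ low :+ x :* X)
           refl x A B (seqG true l) (seqJ true l) X low ⟩
    w * (w * (x * X - x * A + B)) + κ 2 * x * (w * (w * seqG true l)) + w * (w * seqJ true l) + low + x * X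
      ≈⟨ +-congʳ (+-congʳ (+-cong (+-congˡ (*-congˡ (*-congˡ (wG-closed h)))) (proj₁ (ww-closed h)))) ⟩
    w * (w * (x * X - x * A + B)) + κ 2 * x * (w * wG (κ h) A B X) + wwJ (κ h) A B X + low + x * X
      ≈⟨ solve 5 (λ x A B X η →
           :w x :* (:w x :* (x :* X :- x :* A :+ B)) :+ :κ 2 :* x :* (:w x :* :wG x η A B X) :+ :wwJ x η A B X
           :+ (:κ 8 :* (x :* (x :* (x :* A))) :+ :κ 8 :* (x :* (x :* A)) :+ :κ 2 :* (x :* A)) :+ x :* X
           := :κ 8 :* (x :* (x :* (x :* X)))
              :+ ((:κ 24 :+ :κ 8 :* η) :* (x :* (x :* B)) :+ (:κ 11 :+ :κ 6 :* η) :* (x :* B) :+ (:κ 1 :+ η) :* B))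
           refl x A B X (κ h) ⟩
    κ 8 * (x * (x * (x * X)))
    + ((κ 24 + κ 8 * κ h) * (x * (x * B)) + (κ 11 + κ 6 * κ h) * (x * B) + (κ 1 + κ h) * B)
      ≈⟨ +-congˡ (+-cong (+-cong (*-congʳ (affine 24 8)) (*-congʳ (affine 11 6))) (*-congʳ (κ-+ 1 h))) ⟨
    κ 8 * (x * (x * (x * X)))
    + (κ (24 ℕ.+ 8 ℕ.* h) * (x * (x * B)) + κ (11 ℕ.+ 6 ℕ.* h) * (x * B) + κ (1 ℕ.+ h) * B) ∎
    where
    l = twice h
    U = defect h
    A = seqA l
    B = seqB l
    X = evenPower h
    low = κ 8 * (x * (x * (x * A))) + κ 8 * (x * (x * A)) + κ 2 * (x * A)
    affine : ∀ c d → κ (c ℕ.+ d ℕ.* h) ≈ κ c + κ d * κ h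
    affine c d = trans (κ-+ c (d ℕ.* h)) (+-congˡ (trans (reflexive (≡.cong ι (ℤP.pos-* d h))) (*-homo (+ d) (+ h))))

-- Coefficients counted from the top degree.

module Coefficients where
  open import Defs
  open Polynomials
  open PathDistances using (twice; twice≡2*; parity)
  open import Data.Bool using (true; not)
  open import Data.Integer using (ℤ; 0ℤ; 1ℤ; +_; ∣_∣)
  import Data.Integer as ℤ
  import Data.Integer.Tactic.RingSolver as ℤSolver
  open import Data.List using (_∷_; map)
  open import Data.Nat using (ℕ; zero; suc; _+_; _*_; _∸_; _≤_; _<_; z≤n; s≤s; z<s; s<s)
  import Data.Nat.Properties as ℕP
  import Data.Nat.Tactic.RingSolver as ℕSolver
  open import Data.Product using (∃; _×_; _,_; proj₁; proj₂)
  open import Relation.Binary.PropositionalEquality using (_≡_; refl; sym; trans; cong; cong₂; module ≡-Reasoning)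
  open import Relation.Nullary using (¬_; yes; no)

  open _≋_

  const-hom : CommutativeRing.rawRing ℤP.+-*-commutativeRing -Raw-AlmostCommutative⟶ fromCommutativeRing polyRing
  const-hom = record
    { ⟦_⟧    = const
    ; +-homo = λ _ _ → coeffwise λ _ → refl
    ; *-homo = λ a b → coeffwise λ { zero → sym (ℤP.+-identityʳ (a ℤ.* b)) ; (suc _) → refl }
    ; -‿homo = λ _ → coeffwise λ _ → refl
    ; 0-homo = 0∷[]≋[]
    ; 1-homo = coeffwise λ _ → refl
    }

  open Transfer polyRing const-hom X
    using (κ; seqA; seqB; seqG; seqJ; seqK; seqP; evenPower; defect; defect-closed)

  coeff-const-* : ∀ c p i → coeff (const c *ₚ p) i ≡ c ℤ.* coeff p i
  coeff-const-* c p i = trans (at (CommutativeRing.+-congˡ polyRing {map (c ℤ.*_) p} 0∷[]≋[]) i)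
    (trans (at (+ₚ-identityʳ (map (c ℤ.*_) p)) i) (coeff-scale c p i))

  X*≋0∷ : ∀ p → X *ₚ p ≋ 0ℤ ∷ p
  X*≋0∷ p = CommutativeRing.trans polyRing (+ₚ-cong (scale-0 p) (∷-cong refl (*ₚ-identityˡ p))) (coeffwise λ _ → refl)

  prev : {A : Set} → A → (ℕ → A) → ℕ → A
  prev z f zero    = z
  prev z f (suc j) = f j

  prevℤ : (ℕ → ℤ) → ℕ → ℤ
  prevℤ = prev 0ℤ

  prevℕ : (ℕ → ℕ) → ℕ → ℕ
  prevℕ = prev 0

  -- f lists the coefficients of p from degree N downwards.
  record Descending (N : ℕ) (p : Poly) (f : ℕ → ℤ) : Set where
    field
      within : ∀ i j → i + j ≡ N → coeff p i ≡ f j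
      above₀ : ∀ i → N < i → coeff p i ≡ 0ℤ
      below₀ : ∀ j → N < j → f j ≡ 0ℤ

  open Descending

  desc-+ : ∀ {N p q f g} → Descending N p f → Descending N q g → Descending N (p +ₚ q) (λ j → f j ℤ.+ g j)
  desc-+ {N} {p} {q} P Q = record
    { within = λ i j e → trans (coeff-+ p q i) (cong₂ ℤ._+_ (within P i j e) (within Q i j e))
    ; above₀ = λ i N<i → trans (coeff-+ p q i) (cong₂ ℤ._+_ (above₀ P i N<i) (above₀ Q i N<i))
    ; below₀ = λ j N<j → cong₂ ℤ._+_ (below₀ P j N<j) (below₀ Q j N<j)
    }

  desc-const* : ∀ {N p f} c → Descending N p f → Descending N (const c *ₚ p) (λ j → c ℤ.* f j)
  desc-const* {N} {p} c P = record
    { within = λ i j e → trans (coeff-const-* c p i) (cong (c ℤ.*_) (within P i j e))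
    ; above₀ = λ i N<i → trans (coeff-const-* c p i) (trans (cong (c ℤ.*_) (above₀ P i N<i)) (ℤP.*-zeroʳ c))
    ; below₀ = λ j N<j → trans (cong (c ℤ.*_) (below₀ P j N<j)) (ℤP.*-zeroʳ c)
    }

  -- Counted from the top, coefficients are unchanged by multiplication by x. The value of f just
  -- beyond N supplies the new constant term 0.
  desc-X* : ∀ {N p f} → Descending N p f → Descending (suc N) (X *ₚ p) f
  desc-X* {N} {p} {f} P = record
    { within = λ { zero j refl → trans (at (X*≋0∷ p) 0) (sym (below₀ P j ℕP.≤-refl))
                 ; (suc i) j e → trans (at (X*≋0∷ p) (suc i)) (within P i j (ℕP.suc-injective e)) }
    ; above₀ = λ { (suc i) (s<s N<i) → trans (at (X*≋0∷ p) (suc i)) (above₀ P i N<i) }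
    ; below₀ = λ j N<j → below₀ P j (ℕP.<-trans (ℕP.n<1+n N) N<j)
    }

  -- Reading p as a polynomial of degree at most N + 1 shifts the sequence; this is how terms of
  -- lower degree are aligned with those of top degree.
  desc-prev : ∀ {N p f} → Descending N p f → Descending (suc N) p (prevℤ f)
  desc-prev {N} {p} {f} P = record
    { within = λ { i zero e → above₀ P i (ℕP.≤-reflexive (trans (sym e) (ℕP.+-identityʳ i)))
                 ; i (suc j) e → within P i j (ℕP.suc-injective (trans (sym (ℕP.+-suc i j)) e)) }
    ; above₀ = λ i N<i → above₀ P i (ℕP.<-trans (ℕP.n<1+n N) N<i)
    ; below₀ = λ { (suc j) (s<s N<j) → below₀ P j N<j }
    }

  desc-cong : ∀ {N p f g} → (∀ j → f j ≡ g j) → Descending N p f → Descending N p g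
  desc-cong f≡g P = record
    { within = λ i j e → trans (within P i j e) (f≡g j)
    ; above₀ = above₀ P
    ; below₀ = λ j N<j → trans (sym (f≡g j)) (below₀ P j N<j)
    }

  desc-unique : ∀ {N p q f g} → p ≋ q → Descending N p f → Descending N q g → ∀ j → f j ≡ g j
  desc-unique {N} p≋q P Q j with j ℕP.≤? N
  ... | yes j≤N = trans (sym (within P (N ∸ j) j (ℕP.m∸n+n≡m j≤N))) (trans (at p≋q (N ∸ j)) (within Q (N ∸ j) j (ℕP.m∸n+n≡m j≤N)))
  ... | no j≰N = trans (below₀ P j (ℕP.≰⇒> j≰N)) (sym (below₀ Q j (ℕP.≰⇒> j≰N)))

  Degree≤ : ℕ → Poly → Set
  Degree≤ N p = ∃ (Descending N p)

  unit₀ : ℕ → ℕ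
  unit₀ zero    = 1
  unit₀ (suc _) = 0

  -- arrA l j = C(l+j, 2j) and arrB l j = C(l+1+j, 2j+1).
  arrA arrB : ℕ → ℕ → ℕ
  arrA zero    j = unit₀ j
  arrA (suc l) j = arrA l j + prevℕ (arrB l) j
  arrB zero    j = unit₀ j
  arrB (suc l) j = arrA (suc l) j + arrB l j

  pos-prev : ∀ (f : ℕ → ℕ) j → prevℤ (λ k → + f k) j ≡ + prevℕ f j
  pos-prev f zero    = refl
  pos-prev f (suc j) = refl

  desc-1 : Descending 0 (κ 1) (λ j → + unit₀ j)
  desc-1 = record
    { within = λ { zero zero _ → refl ; (suc _) _ () ; zero (suc j) () }
    ; above₀ = λ { (suc i) _ → refl }
    ; below₀ = λ { (suc j) _ → refl }
    }

  desc-A : ∀ l → Descending l (seqA l) (λ j → + arrA l j)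
  desc-B : ∀ l → Descending l (seqB l) (λ j → + arrB l j)
  desc-A zero    = desc-1
  desc-A (suc l) = desc-cong (λ j → cong (ℤ._+_ (+ arrA l j)) (pos-prev (arrB l) j))
    (desc-+ (desc-X* (desc-A l)) (desc-prev (desc-B l)))
  desc-B zero    = desc-1
  desc-B (suc l) = desc-+ (desc-A (suc l)) (desc-X* (desc-B l))

  desc-0 : ∀ N → Descending N (κ 0) (λ _ → 0ℤ)
  desc-0 N = record
    { within = λ { zero _ _ → refl ; (suc _) _ _ → refl }
    ; above₀ = λ { (suc i) _ → refl }
    ; below₀ = λ _ _ → refl
    }

  -- The coefficient sequences of G, J and K remain anonymous: what matters about P is drawn from
  -- `coeffU-identity`.
  degree-G : ∀ b l → Degree≤ l (seqG b l)
  degree-G b zero    = _ , desc-0 0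
  degree-G b (suc l) = _ , desc-+ (desc-X* (proj₂ (degree-G (not b) l))) (desc-const* (+ parity b) (desc-prev (desc-B l)))

  degree-J : ∀ b l → Degree≤ l (seqJ b l)
  degree-K : ∀ b l → Degree≤ l (seqK b l)
  degree-K b zero    = _ , desc-0 0
  degree-K b (suc l) = _ , desc-+ (desc-+ (desc-X* (proj₂ (degree-K (not b) l))) (desc-prev (proj₂ (degree-J (not b) l))))
    (desc-const* (+ parity b) (desc-+ (desc-const* (+ 2) (desc-X* (proj₂ (degree-G (not b) l)))) (desc-prev (desc-B l))))
  degree-J b zero    = _ , desc-0 0
  degree-J b (suc l) = _ , desc-+ (proj₂ (degree-K b (suc l))) (desc-X* (proj₂ (degree-J (not b) l)))

  desc-neg : ∀ {N p f} → Descending N p f → Descending N (-ₚ p) (λ j → ℤ.- f j)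
  desc-neg {N} {p} P = record
    { within = λ i j e → trans (coeff-neg p i) (cong ℤ.-_ (within P i j e))
    ; above₀ = λ i N<i → trans (coeff-neg p i) (cong ℤ.-_ (above₀ P i N<i))
    ; below₀ = λ j N<j → cong ℤ.-_ (below₀ P j N<j)
    }

  desc-evenPower : ∀ h → Descending (twice h) (evenPower h) (λ j → + unit₀ j)
  desc-evenPower zero    = desc-1
  desc-evenPower (suc h) = desc-X* (desc-X* (desc-evenPower h))

  degree-P : ∀ l → Degree≤ (suc l) (seqP l)
  degree-P l = _ , desc-+ (desc-+ (desc-+ (desc-X* (desc-A l)) (desc-neg (desc-prev (desc-B l))))
    (desc-neg (desc-const* (+ 2) (desc-X* (proj₂ (degree-G true l))))))
    (desc-neg (desc-prev (proj₂ (degree-J true l))))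

  coeffP coeffU : ℕ → ℕ → ℤ
  coeffP h = proj₁ (degree-P (twice h))
  coeffU h j = + unit₀ j ℤ.+ ℤ.- coeffP h j

  desc-U : ∀ h → Descending (suc (twice h)) (defect h) (coeffU h)
  desc-U h = desc-+ (desc-X* (desc-evenPower h)) (desc-neg (proj₂ (degree-P (twice h))))

  -- The coefficients of x^(2h+3-j) in `defect-closed`. A term whose degree falls short of 2h + 3 by
  -- k carries k applications of `prevℤ`.
  coeffU-identity : ∀ h → let q = coeffU h ; l = twice h
                              a = λ j → + arrA l j ; b = λ j → + arrB l j ; ε = λ j → + unit₀ j in ∀ j →
    + 16 ℤ.* q j ℤ.+ + 8 ℤ.* prevℤ q j ℤ.+ prevℤ (prevℤ q) j
    ℤ.+ (+ 8 ℤ.* a j ℤ.+ + 8 ℤ.* prevℤ a j ℤ.+ + 2 ℤ.* prevℤ (prevℤ a) j)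
    ℤ.+ prevℤ (prevℤ ε) j
    ≡ + 8 ℤ.* ε j
    ℤ.+ (+ (24 + 8 * h) ℤ.* prevℤ b j ℤ.+ + (11 + 6 * h) ℤ.* prevℤ (prevℤ b) j
         ℤ.+ + (1 + h) ℤ.* prevℤ (prevℤ (prevℤ b)) j)
  coeffU-identity h = desc-unique (defect-closed h)
    (desc-+ (desc-+
      (desc-+ (desc-+ (desc-const* (+ 16) (desc-X* (desc-X* U))) (desc-const* (+ 8) (desc-prev (desc-X* U))))
              (desc-prev (desc-prev U)))
      (desc-+ (desc-+ (desc-const* (+ 8) (desc-X* (desc-X* (desc-X* A)))) (desc-const* (+ 8) (desc-prev (desc-X* (desc-X* A)))))
              (desc-const* (+ 2) (desc-prev (desc-prev (desc-X* A))))))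
      (desc-prev (desc-prev (desc-X* Xʰ))))
    (desc-+ (desc-const* (+ 8) (desc-X* (desc-X* (desc-X* Xʰ))))
      (desc-+ (desc-+ (desc-const* (+ (24 + 8 * h)) (desc-prev (desc-X* (desc-X* B′))))
                      (desc-const* (+ (11 + 6 * h)) (desc-prev (desc-prev (desc-X* B′)))))
              (desc-const* (+ (1 + h)) (desc-prev (desc-prev (desc-prev B′))))))
    where
    U  = desc-U h
    A  = desc-A (twice h)
    B′ = desc-B (twice h)
    Xʰ = desc-evenPower h

  -- Ratios of neighbouring binomial coefficients: (2k+2) C(l+k+1, 2k+2) = (l-k) C(l+k+1, 2k+1),
  -- with the subtraction moved across, and (2k+1) C(l+k+1, 2k+1) = (l+k+1) C(l+k, 2k). The two are
  -- proved together because the recursions of `arrA` and `arrB` are interleaved.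
  A-from-B : ∀ l k → 2 * suc k * arrA l (suc k) + suc k * arrB l k ≡ suc l * arrB l k
  B-from-A : ∀ l k → suc (2 * k) * arrB l k ≡ (suc l + k) * arrA l k
  B-from-A zero    zero    = refl
  B-from-A zero    (suc k) = trans (ℕP.*-zeroʳ (suc (2 * suc k))) (sym (ℕP.*-zeroʳ (1 + suc k)))
  B-from-A (suc l) zero    = go (arrA l 0) (arrB l 0) (B-from-A l 0)
    where
    go : ∀ u t → 1 * t ≡ (suc l + 0) * u → 1 * ((u + 0) + t) ≡ (suc (suc l) + 0) * (u + 0)
    go u t h = trans (lemma₁ u t) (trans (cong (_+_ u) h) (lemma₂ u l))
      where
      lemma₁ : ∀ u t → 1 * ((u + 0) + t) ≡ u + 1 * t
      lemma₁ = ℕSolver.solve-∀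
      lemma₂ : ∀ u l → u + (suc l + 0) * u ≡ (suc (suc l) + 0) * (u + 0)
      lemma₂ = ℕSolver.solve-∀
  B-from-A (suc l) (suc k) = go (arrA l (suc k)) (arrB l k) (arrB l (suc k)) (A-from-B l k) (B-from-A l (suc k))
    where
    go : ∀ u v t → 2 * suc k * u + suc k * v ≡ suc l * v → suc (2 * suc k) * t ≡ (suc l + suc k) * u →
      suc (2 * suc k) * ((u + v) + t) ≡ (suc (suc l) + suc k) * (u + v)
    go u v t h₁ h₂ = trans (lemma₁ k u v t) (trans (cong₂ (λ y z → y + z + (suc (suc k) * v + u)) h₁ h₂) (lemma₂ k l u v))
      where
      lemma₁ : ∀ k u v t → suc (2 * suc k) * ((u + v) + t)
        ≡ (2 * suc k * u + suc k * v) + suc (2 * suc k) * t + (suc (suc k) * v + u)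
      lemma₁ = ℕSolver.solve-∀
      lemma₂ : ∀ k l u v → suc l * v + (suc l + suc k) * u + (suc (suc k) * v + u) ≡ (suc (suc l) + suc k) * (u + v)
      lemma₂ = ℕSolver.solve-∀
  A-from-B zero    zero    = refl
  A-from-B zero    (suc k) = lemma k
    where
    lemma : ∀ k → 2 * suc (suc k) * 0 + suc (suc k) * 0 ≡ 1 * 0
    lemma = ℕSolver.solve-∀
  A-from-B (suc l) k = go (arrA l (suc k)) (arrB l k) (arrA (suc l) k) (A-from-B l k) (B-from-A (suc l) k)
    where
    go : ∀ u v α → 2 * suc k * u + suc k * v ≡ suc l * v → suc (2 * k) * (α + v) ≡ (suc (suc l) + k) * α →
      2 * suc k * (u + v) + suc k * (α + v) ≡ suc (suc l) * (α + v)
    go u v α h₁ h₂ = ℕP.+-cancelʳ-≡ (k * α) _ _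
      (trans (lemma₁ k u v α) (trans (cong₂ (λ y z → y + z + v) h₁ h₂) (lemma₂ k l v α)))
      where
      lemma₁ : ∀ k u v α → (2 * suc k * (u + v) + suc k * (α + v)) + k * α ≡ (2 * suc k * u + suc k * v) + suc (2 * k) * (α + v) + v
      lemma₁ = ℕSolver.solve-∀
      lemma₂ : ∀ k l v α → suc l * v + (suc (suc l) + k) * α + v ≡ suc (suc l) * (α + v) + k * α
      lemma₂ = ℕSolver.solve-∀

  arrB-positive : ∀ l k → k ≤ l → 1 ≤ arrB l k
  arrB-positive zero    zero    _ = s≤s z≤n
  arrB-positive (suc l) zero    _ = ℕP.≤-trans (arrB-positive l 0 z≤n) (ℕP.m≤n+m _ _)
  arrB-positive (suc l) (suc k) (s≤s k≤l) = ℕP.≤-trans (arrB-positive l k k≤l)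
    (ℕP.≤-trans (ℕP.m≤n+m _ (arrA l (suc k))) (ℕP.m≤m+n _ _))

  -- The ratio of the two values is (l+k+2)(l-k) / ((2k+2)(2k+3)). At l = 3k + 3 its numerator is
  -- (4k+5)(2k+3), just above the 2(2k+2)(2k+3) that is required.
  arrB-doubles : ∀ l k → 3 * k + 3 ≤ l → 2 * arrB l k ≤ arrB l (suc k)
  arrB-doubles l k bound with d , refl ← ℕP.m≤n⇒∃[o]m+o≡n bound =
    ℕP.*-cancelˡ-≤ (suc (2 * suc k) * (2 * suc k)) (begin
      (suc (2 * suc k) * (2 * suc k)) * (2 * v)
        ≤⟨ ℕP.≤-trans (ℕP.m≤m+n _ ((2 * k + 3) * v + (6 * k + 8 + d) * d * v)) (ℕP.≤-reflexive (lemma₁ k d v)) ⟩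
      (suc l + suc k) * ((2 * k + 3 + d) * v)
        ≡⟨ cong ((suc l + suc k) *_) (sym step) ⟩
      (suc l + suc k) * (2 * suc k * u)
        ≡⟨ lemma₂ (suc l + suc k) (2 * suc k) u ⟩
      2 * suc k * ((suc l + suc k) * u)
        ≡⟨ cong (2 * suc k *_) (sym (B-from-A l (suc k))) ⟩
      2 * suc k * (suc (2 * suc k) * t)
        ≡⟨ lemma₃ (2 * suc k) (suc (2 * suc k)) t ⟩
      (suc (2 * suc k) * (2 * suc k)) * t ∎)
    where
    open ℕP.≤-Reasoning
    u = arrA l (suc k)
    v = arrB l k
    t = arrB l (suc k)
    step : 2 * suc k * u ≡ (2 * k + 3 + d) * v
    step = ℕP.+-cancelʳ-≡ (suc k * v) _ _ (trans (A-from-B l k) (lemma k d v))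
      where
      lemma : ∀ k d v → suc (3 * k + 3 + d) * v ≡ (2 * k + 3 + d) * v + suc k * v
      lemma = ℕSolver.solve-∀
    lemma₁ : ∀ k d v → (suc (2 * suc k) * (2 * suc k)) * (2 * v) + ((2 * k + 3) * v + (6 * k + 8 + d) * d * v)
      ≡ (suc (3 * k + 3 + d) + suc k) * ((2 * k + 3 + d) * v)
    lemma₁ = ℕSolver.solve-∀
    lemma₂ : ∀ a b c → a * (b * c) ≡ b * (a * c)
    lemma₂ = ℕSolver.solve-∀
    lemma₃ : ∀ a b c → a * (b * c) ≡ (b * a) * c
    lemma₃ = ℕSolver.solve-∀

  arrA-0 : ∀ l → arrA l 0 ≡ 1
  arrA-0 zero    = refl
  arrA-0 (suc l) = trans (ℕP.+-identityʳ _) (arrA-0 l)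

  -- Doubling of the right-hand side.

  module Growth (l′ h : ℕ) (l≡2h : suc l′ ≡ 2 * h) where
    l : ℕ
    l = suc l′
    a b b′ : ℕ → ℕ
    a  = arrA l
    b  = arrB l
    b′ = arrB l′

    -- By `A-from-B`, 8 a(i+1) equals 4(2h-i)/(i+1) times b(i), so subtracting it from 8h b(i)
    -- leaves 4(2h+1) i/(i+1) times b(i).
    surplus-scaled : ∀ i → suc i * (8 * h * b i) ≡ suc i * (8 * a (suc i)) + 4 * suc l * (i * b i)
    surplus-scaled i = ℕP.+-cancelʳ-≡ (4 * (suc i * b i)) _ _ (begin
      suc i * (8 * h * b i) + 4 * (suc i * b i)        ≡⟨ lemma₁ i h (b i) ⟩
      4 * suc (2 * h) * (i * b i) + 4 * (suc (2 * h) * b i) ≡⟨ cong (λ m → 4 * suc m * (i * b i) + 4 * (suc m * b i)) (sym l≡2h) ⟩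
      4 * suc l * (i * b i) + 4 * (suc l * b i)        ≡⟨ cong (λ m → 4 * suc l * (i * b i) + 4 * m) (sym (A-from-B l i)) ⟩
      4 * suc l * (i * b i) + 4 * (2 * suc i * a (suc i) + suc i * b i) ≡⟨ lemma₂ i (4 * suc l * (i * b i)) (a (suc i)) (b i) ⟩
      (suc i * (8 * a (suc i)) + 4 * suc l * (i * b i)) + 4 * (suc i * b i) ∎)
      where
      open ≡-Reasoning
      lemma₁ : ∀ i h b → suc i * (8 * h * b) + 4 * (suc i * b) ≡ 4 * suc (2 * h) * (i * b) + 4 * (suc (2 * h) * b)
      lemma₁ = ℕSolver.solve-∀
      lemma₂ : ∀ i c a b → c + 4 * (2 * suc i * a + suc i * b) ≡ (suc i * (8 * a) + c) + 4 * (suc i * b)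
      lemma₂ = ℕSolver.solve-∀

    -- Both terms have the same order of magnitude, so the difference is needed
    -- exactly; the other negative terms are absorbed by b = a + b′.
    surplus : ℕ → ℕ
    surplus i = 8 * h * b i ∸ 8 * a (suc i)

    surplus-spec : ∀ i → 8 * h * b i ≡ 8 * a (suc i) + surplus i
    surplus-spec i = sym (ℕP.m+[n∸m]≡n {8 * a (suc i)} (ℕP.*-cancelˡ-≤ (suc i)
      (ℕP.≤-trans (ℕP.m≤m+n (suc i * (8 * a (suc i))) (4 * suc l * (i * b i))) (ℕP.≤-reflexive (sym (surplus-scaled i))))))

    surplus-formula : ∀ i → suc i * surplus i ≡ 4 * suc l * (i * b i)
    surplus-formula i = ℕP.+-cancelˡ-≡ (suc i * (8 * a (suc i))) _ _
      (trans (sym (ℕP.*-distribˡ-+ (suc i) (8 * a (suc i)) (surplus i)))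
        (trans (cong (suc i *_) (sym (surplus-spec i))) (surplus-scaled i)))

    -- The surplus is a constant times i/(i+1) times b(i), and i/(i+1) increases with i.
    surplus-doubles : ∀ i → 2 * b i ≤ b (suc i) → 2 * surplus i ≤ surplus (suc i)
    surplus-doubles i doubles = ℕP.*-cancelˡ-≤ (suc (suc i) * suc i) (begin
      (suc (suc i) * suc i) * (2 * surplus i)              ≡⟨ lemma₁ (suc (suc i)) (suc i) (surplus i) ⟩
      2 * suc (suc i) * (suc i * surplus i)                ≡⟨ cong (2 * suc (suc i) *_) (surplus-formula i) ⟩
      2 * suc (suc i) * (4 * suc l * (i * b i))            ≤⟨ ℕP.m≤m+n _ (8 * suc l * b i) ⟩
      2 * suc (suc i) * (4 * suc l * (i * b i)) + 8 * suc l * b i ≡⟨ lemma₂ i (suc l) (b i) ⟩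
      suc i * (4 * suc l * (suc i * (2 * b i)))
        ≤⟨ ℕP.*-monoʳ-≤ (suc i) (ℕP.*-monoʳ-≤ (4 * suc l) (ℕP.*-monoʳ-≤ (suc i) doubles)) ⟩
      suc i * (4 * suc l * (suc i * b (suc i)))            ≡⟨ cong (suc i *_) (sym (surplus-formula (suc i))) ⟩
      suc i * (suc (suc i) * surplus (suc i))              ≡⟨ lemma₃ (suc i) (suc (suc i)) (surplus (suc i)) ⟩
      (suc (suc i) * suc i) * surplus (suc i)              ∎)
      where
      open ℕP.≤-Reasoning
      lemma₁ : ∀ m n z → (m * n) * (2 * z) ≡ 2 * m * (n * z)
      lemma₁ = ℕSolver.solve-∀
      lemma₂ : ∀ i s b → 2 * suc (suc i) * (4 * s * (i * b)) + 8 * s * b ≡ suc i * (4 * s * (suc i * (2 * b)))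
      lemma₂ = ℕSolver.solve-∀
      lemma₃ : ∀ m n z → m * (n * z) ≡ (n * m) * z
      lemma₃ = ℕSolver.solve-∀

    -- The terms in b after all terms in a have been subtracted: 24 is split as 16 + 8 and 11 as 9 +
    -- 2, and in the parts 8 and 2 the difference b - a is b′. Only sums of nonnegative terms
    -- remain.
    rhs : ℕ → ℕ
    rhs i = surplus i + 16 * b i + 8 * b′ i + (9 + 6 * h) * prevℕ b i + 2 * prevℕ b′ i + (1 + h) * prevℕ (prevℕ b) i

    rhs-spec : ∀ i → (24 + 8 * h) * b i + (11 + 6 * h) * prevℕ b i + (1 + h) * prevℕ (prevℕ b) i
      ≡ (8 * a (suc i) + 8 * a i + 2 * prevℕ a i) + rhs i
    rhs-spec i = begin
      (24 + 8 * h) * b i + (11 + 6 * h) * prevℕ b i + c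
        ≡⟨ lemma₁ h (b i) (prevℕ b i) c ⟩
      8 * h * b i + 16 * b i + 8 * (a i + b′ i) + (9 + 6 * h) * prevℕ b i + 2 * prevℕ b i + c
        ≡⟨ cong₂ (λ y z → y + 16 * b i + 8 * (a i + b′ i) + (9 + 6 * h) * prevℕ b i + 2 * z + c) (surplus-spec i) (prev-split i) ⟩
      8 * a (suc i) + surplus i + 16 * b i + 8 * (a i + b′ i) + (9 + 6 * h) * prevℕ b i + 2 * (prevℕ a i + prevℕ b′ i) + c
        ≡⟨ lemma₂ (a (suc i)) (surplus i) (16 * b i) (a i) (b′ i) ((9 + 6 * h) * prevℕ b i) (prevℕ a i) (prevℕ b′ i) c ⟩
      (8 * a (suc i) + 8 * a i + 2 * prevℕ a i) + rhs i ∎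
      where
      open ≡-Reasoning
      c = (1 + h) * prevℕ (prevℕ b) i
      prev-split : ∀ i → prevℕ b i ≡ prevℕ a i + prevℕ b′ i
      prev-split zero    = refl
      prev-split (suc i) = refl
      lemma₁ : ∀ h b p c → (24 + 8 * h) * b + (11 + 6 * h) * p + c ≡ 8 * h * b + 16 * b + 8 * b + (9 + 6 * h) * p + 2 * p + c
      lemma₁ = ℕSolver.solve-∀
      lemma₂ : ∀ A z B a b p α β c → 8 * A + z + B + 8 * (a + b) + p + 2 * (α + β) + c
        ≡ (8 * A + 8 * a + 2 * α) + (z + B + 8 * b + p + 2 * β + c)
      lemma₂ = ℕSolver.solve-∀

    prev-doubles : ∀ (g : ℕ → ℕ) i → (∀ k → k < i → 2 * g k ≤ g (suc k)) → 2 * prevℕ g i ≤ prevℕ g (suc i)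
    prev-doubles g zero    _  = z≤n
    prev-doubles g (suc i) hg = hg i ℕP.≤-refl

    -- Each summand doubles separately. The bound has 4 in place of 3 because b′ lives at level l -
    -- 1.
    rhs-doubles : ∀ i → 3 * i + 4 ≤ l → 2 * rhs i ≤ rhs (suc i)
    rhs-doubles i bound = ℕP.≤-trans
      (ℕP.≤-reflexive (lemma (surplus i) (b i) (b′ i) (9 + 6 * h) (prevℕ b i) (prevℕ b′ i) (1 + h) (prevℕ (prevℕ b) i)))
      (ℕP.+-mono-≤ (ℕP.+-mono-≤ (ℕP.+-mono-≤ (ℕP.+-mono-≤ (ℕP.+-mono-≤
        (surplus-doubles i (b-doubles i ℕP.≤-refl))
        (ℕP.*-monoʳ-≤ 16 (b-doubles i ℕP.≤-refl)))
        (ℕP.*-monoʳ-≤ 8 (b′-doubles i ℕP.≤-refl)))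
        (ℕP.*-monoʳ-≤ (9 + 6 * h) (prev-doubles b i (λ k k<i → b-doubles k (ℕP.<⇒≤ k<i)))))
        (ℕP.*-monoʳ-≤ 2 (prev-doubles b′ i (λ k k<i → b′-doubles k (ℕP.<⇒≤ k<i)))))
        (ℕP.*-monoʳ-≤ (1 + h) (prev²-doubles i ℕP.≤-refl)))
      where
      lemma : ∀ z b b′ c p p′ d r → 2 * (z + 16 * b + 8 * b′ + c * p + 2 * p′ + d * r)
        ≡ 2 * z + 16 * (2 * b) + 8 * (2 * b′) + c * (2 * p) + 2 * (2 * p′) + d * (2 * r)
      lemma = ℕSolver.solve-∀
      b′-doubles : ∀ k → k ≤ i → 2 * b′ k ≤ b′ (suc k)
      b′-doubles k k≤i = arrB-doubles l′ k (ℕP.≤-trans (ℕP.+-monoˡ-≤ 3 (ℕP.*-monoʳ-≤ 3 k≤i))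
        (ℕP.≤-pred (ℕP.≤-trans (ℕP.≤-reflexive (sym (ℕP.+-suc (3 * i) 3))) bound)))
      b-doubles : ∀ k → k ≤ i → 2 * b k ≤ b (suc k)
      b-doubles k k≤i = arrB-doubles l k (ℕP.≤-trans (ℕP.+-mono-≤ (ℕP.*-monoʳ-≤ 3 k≤i) (ℕP.n≤1+n 3)) bound)
      prev²-doubles : ∀ k → k ≤ i → 2 * prevℕ (prevℕ b) k ≤ prevℕ (prevℕ b) (suc k)
      prev²-doubles zero          _   = z≤n
      prev²-doubles (suc zero)    _   = z≤n
      prev²-doubles (suc (suc k)) k≤i = b-doubles k (ℕP.≤-trans (ℕP.m≤n+m k 2) k≤i)

    rhs-large : ∀ i → i ≤ l′ → 24 ≤ rhs i
    rhs-large i i≤l′ = begin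
      16 + 8
        ≤⟨ ℕP.+-mono-≤ (ℕP.*-monoʳ-≤ 16 (arrB-positive l i (ℕP.m≤n⇒m≤1+n i≤l′))) (ℕP.*-monoʳ-≤ 8 (arrB-positive l′ i i≤l′)) ⟩
      16 * b i + 8 * b′ i                   ≤⟨ ℕP.+-monoˡ-≤ (8 * b′ i) (ℕP.m≤n+m (16 * b i) (surplus i)) ⟩
      surplus i + 16 * b i + 8 * b′ i
        ≤⟨ ℕP.≤-trans (ℕP.m≤m+n _ ((9 + 6 * h) * prevℕ b i)) (ℕP.≤-trans (ℕP.m≤m+n _ (2 * prevℕ b′ i)) (ℕP.m≤m+n _ _)) ⟩
      rhs i                                 ∎
      where open ℕP.≤-Reasoning

  -- Strict increase of the coefficients from the top.

  module Increase (h′ : ℕ) where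
    h : ℕ
    h = suc h′
    open Growth (suc (twice h′)) h (twice≡2* h)

    q : ℕ → ℤ
    q = coeffU h

    recurrence : ∀ i → + 16 ℤ.* q (suc i) ℤ.+ + 8 ℤ.* q i ℤ.+ prevℤ q i ℤ.+ + prevℕ unit₀ i ≡ + rhs i
    recurrence i = begin
      Q ℤ.+ E                                   ≡⟨ lemma₁ Q L E ⟩
      (Q ℤ.+ L ℤ.+ E) ℤ.+ ℤ.- L                 ≡⟨ cong (ℤ._+ ℤ.- L) identity ⟩
      (L ℤ.+ + rhs i) ℤ.+ ℤ.- L                 ≡⟨ lemma₂ L (+ rhs i) ⟩
      + rhs i                                   ∎
      where
      open ≡-Reasoning
      Q E L : ℤ
      Q = + 16 ℤ.* q (suc i) ℤ.+ + 8 ℤ.* q i ℤ.+ prevℤ q i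
      E = + prevℕ unit₀ i
      L = + (8 * a (suc i) + 8 * a i + 2 * prevℕ a i)
      lemma₁ : ∀ Q L E → Q ℤ.+ E ≡ (Q ℤ.+ L ℤ.+ E) ℤ.+ ℤ.- L
      lemma₁ = ℤSolver.solve-∀
      lemma₂ : ∀ L r → (L ℤ.+ r) ℤ.+ ℤ.- L ≡ r
      lemma₂ = ℤSolver.solve-∀
      pos-combination : ∀ c x d y e z → + c ℤ.* + x ℤ.+ + d ℤ.* + y ℤ.+ + e ℤ.* + z ≡ + (c * x + d * y + e * z)
      pos-combination c x d y e z = sym (cong₂ ℤ._+_ (cong₂ ℤ._+_ (ℤP.pos-* c x) (ℤP.pos-* d y)) (ℤP.pos-* e z))
      pos-prev² : ∀ i → prevℤ (prevℤ (λ k → + b k)) i ≡ + prevℕ (prevℕ b) i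
      pos-prev² zero    = refl
      pos-prev² (suc i) = pos-prev b i
      identity : Q ℤ.+ L ℤ.+ E ≡ L ℤ.+ + rhs i
      identity = begin
        Q ℤ.+ L ℤ.+ E
          ≡⟨ cong₂ (λ y z → Q ℤ.+ y ℤ.+ z) (trans (sym (pos-combination 8 (a (suc i)) 8 (a i) 2 (prevℕ a i)))
               (cong (λ y → + 8 ℤ.* + a (suc i) ℤ.+ + 8 ℤ.* + a i ℤ.+ + 2 ℤ.* y) (sym (pos-prev a i)))) (sym (pos-prev unit₀ i)) ⟩
        _ ≡⟨ coeffU-identity h (suc i) ⟩
        _ ≡⟨ ℤP.+-identityˡ _ ⟩
        _ ≡⟨ cong₂ (λ y z → + (24 + 8 * h) ℤ.* + b i ℤ.+ + (11 + 6 * h) ℤ.* y ℤ.+ + (1 + h) ℤ.* z) (pos-prev b i) (pos-prev² i) ⟩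
        _ ≡⟨ pos-combination (24 + 8 * h) (b i) (11 + 6 * h) (prevℕ b i) (1 + h) (prevℕ (prevℕ b) i) ⟩
        _ ≡⟨ cong +_ (rhs-spec i) ⟩
        L ℤ.+ + rhs i ∎

    q-0 : q 0 ≡ 0ℤ
    q-0 = ℤP.*-cancelˡ-≡ (+ 16) (q 0) 0ℤ (begin
      + 16 ℤ.* q 0
        ≡⟨ lemma (q 0) ⟩
      (+ 16 ℤ.* q 0 ℤ.+ 0ℤ ℤ.+ 0ℤ ℤ.+ (+ 8 ℤ.* 1ℤ ℤ.+ 0ℤ ℤ.+ 0ℤ) ℤ.+ 0ℤ) ℤ.+ ℤ.- + 8
        ≡⟨ cong (λ y → (+ 16 ℤ.* q 0 ℤ.+ 0ℤ ℤ.+ 0ℤ ℤ.+ (+ 8 ℤ.* + y ℤ.+ 0ℤ ℤ.+ 0ℤ) ℤ.+ 0ℤ) ℤ.+ ℤ.- + 8) (sym (arrA-0 (twice h))) ⟩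
      _ ≡⟨ cong (ℤ._+ ℤ.- + 8) (coeffU-identity h 0) ⟩
      (+ 8 ℤ.+ (+ (24 + 8 * h) ℤ.* 0ℤ ℤ.+ + (11 + 6 * h) ℤ.* 0ℤ ℤ.+ + (1 + h) ℤ.* 0ℤ)) ℤ.+ ℤ.- + 8
        ≡⟨ lemma′ (+ (24 + 8 * h)) (+ (11 + 6 * h)) (+ (1 + h)) ⟩
      + 16 ℤ.* 0ℤ ∎)
      where
      open ≡-Reasoning
      lemma : ∀ y → + 16 ℤ.* y ≡ (+ 16 ℤ.* y ℤ.+ 0ℤ ℤ.+ 0ℤ ℤ.+ (+ 8 ℤ.* 1ℤ ℤ.+ 0ℤ ℤ.+ 0ℤ) ℤ.+ 0ℤ) ℤ.+ ℤ.- + 8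
      lemma = ℤSolver.solve-∀
      lemma′ : ∀ c d e → (+ 8 ℤ.+ (c ℤ.* 0ℤ ℤ.+ d ℤ.* 0ℤ ℤ.+ e ℤ.* 0ℤ)) ℤ.+ ℤ.- + 8 ≡ + 16 ℤ.* 0ℤ
      lemma′ = ℤSolver.solve-∀

    unit₀≤1 : ∀ i → prevℕ unit₀ i ≤ 1
    unit₀≤1 zero          = z≤n
    unit₀≤1 (suc zero)    = ℕP.≤-refl
    unit₀≤1 (suc (suc i)) = z≤n

    -- The final 1 absorbs the unit term of the recurrence, which comes from the summand x · x^2h.
    rhs-upper : ∀ i {c d e} → q (suc i) ℤ.≤ + c → q i ≡ + d → prevℤ q i ≡ + e →
      rhs i ≤ 16 * c + 8 * d + e + 1
    rhs-upper i {c} {d} {e} q≤c q≡d q≡e = ℤP.drop‿+≤+ (ℤP.≤-trans (ℤP.≤-reflexive (sym (recurrence i)))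
      (ℤP.+-mono-≤ (ℤP.+-mono-≤ (ℤP.+-mono-≤
        (ℤP.≤-trans (ℤP.*-monoˡ-≤-nonNeg (+ 16) q≤c) (ℤP.≤-reflexive (sym (ℤP.pos-* 16 c))))
        (ℤP.≤-reflexive (trans (cong (+ 8 ℤ.*_) q≡d) (sym (ℤP.pos-* 8 d)))))
        (ℤP.≤-reflexive q≡e))
        (ℤ.+≤+ (unit₀≤1 i))))

    rhs-exact : ∀ i {c d e} → q (suc i) ≡ + c → q i ≡ + d → prevℤ q i ≡ + e →
      16 * c + 8 * d + e ≤ rhs i
    rhs-exact i {c} {d} {e} q≡c q≡d q≡e = ℤP.drop‿+≤+ (begin
      + (16 * c + 8 * d + e)
        ≡⟨ cong₂ (λ y z → y ℤ.+ z ℤ.+ + e) (ℤP.pos-* 16 c) (ℤP.pos-* 8 d) ⟩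
      + 16 ℤ.* + c ℤ.+ + 8 ℤ.* + d ℤ.+ + e
        ≡⟨ cong₂ ℤ._+_ (cong₂ (λ y z → + 16 ℤ.* y ℤ.+ + 8 ℤ.* z) (sym q≡c) (sym q≡d)) (sym q≡e) ⟩
      + 16 ℤ.* q (suc i) ℤ.+ + 8 ℤ.* q i ℤ.+ prevℤ q i
        ≤⟨ ℤP.i≤i+j _ (+ prevℕ unit₀ i) ⟩
      + 16 ℤ.* q (suc i) ℤ.+ + 8 ℤ.* q i ℤ.+ prevℤ q i ℤ.+ + prevℕ unit₀ i
        ≡⟨ recurrence i ⟩
      + rhs i ∎)
      where open ℤP.≤-Reasoning

    record Rising (i : ℕ) : Set where
      field
        c₀ c₁ c₂ : ℕ
        q₀ : prevℤ q i ≡ + c₀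
        q₁ : q i ≡ + c₁
        q₂ : q (suc i) ≡ + c₂
        c₁<c₂ : c₁ < c₂

    above-pos : ∀ {z c} → + c ℤ.< z → ∃ λ d → z ≡ + d × c < d
    above-pos {+ d} (ℤ.+<+ c<d) = d , refl , c<d

    -- If q 1 were at most 1, `rhs 0` would be at most 17, but it is at least 24. The value must
    -- exceed 1, not merely 0, since it is compared with the leading coefficient 1 of P.
    q-1 : ∃ λ c → q 1 ≡ + c × 1 < c
    q-1 = above-pos (ℤP.≰⇒> λ q≤1 → ℕP.<⇒≱ (s≤s (ℕP.m≤m+n 17 6))
      (ℕP.≤-trans (rhs-large 0 z≤n) (rhs-upper 0 q≤1 q-0 refl)))

    rising : ∀ i → 3 * i + 1 ≤ twice h → Rising i
    rising zero    _     = record { q₀ = refl ; q₁ = q-0 ; q₂ = proj₁ (proj₂ q-1) ; c₁<c₂ = ℕP.<-trans z<s (proj₂ (proj₂ q-1)) }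
    rising (suc i) bound = record { q₀ = q₁ ; q₁ = q₂ ; q₂ = proj₁ (proj₂ next) ; c₁<c₂ = proj₂ (proj₂ next) }
      where
      3i+4≤l : 3 * i + 4 ≤ twice h
      3i+4≤l = ℕP.≤-trans (ℕP.≤-reflexive (lemma i)) bound
        where
        lemma : ∀ i → 3 * i + 4 ≡ 3 * suc i + 1
        lemma = ℕSolver.solve-∀
      open Rising (rising i (ℕP.≤-trans (ℕP.+-monoʳ-≤ (3 * i) (s≤s z≤n)) 3i+4≤l))
      i≤l′ : i ≤ suc (twice h′)
      i≤l′ = ℕP.≤-pred (ℕP.≤-trans (ℕP.≤-trans (ℕP.≤-reflexive (ℕP.+-comm 1 i))
        (ℕP.+-mono-≤ (ℕP.m≤m+n i (i + (i + 0))) (s≤s z≤n))) 3i+4≤l)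
      -- Without an increase, `rhs (suc i)` is at most 24 c₂ + c₁ + 1, whereas `rhs i` is at least
      -- 16 c₂ + 8 c₁ + c₀. The weights 2 and 3 make the terms in c₂ cancel, as 2 · 24 = 3 · 16, and
      -- the fourth copy of `rhs i` supplies the 24 that decides.
      absurd : ¬ (q (suc (suc i)) ℤ.≤ + c₂)
      absurd q≤c₂ = ℕP.<⇒≱ too-large (begin
        3 * (16 * c₂ + 8 * c₁ + c₀) + 24        ≤⟨ ℕP.+-mono-≤ (ℕP.*-monoʳ-≤ 3 (rhs-exact i q₂ q₁ q₀)) (rhs-large i i≤l′) ⟩
        3 * rhs i + rhs i                       ≡⟨ lemma₁ (rhs i) ⟩
        2 * (2 * rhs i)                         ≤⟨ ℕP.*-monoʳ-≤ 2 (rhs-doubles i 3i+4≤l) ⟩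
        2 * rhs (suc i)                         ≤⟨ ℕP.*-monoʳ-≤ 2 (rhs-upper (suc i) q≤c₂ q₂ q₁) ⟩
        2 * (16 * c₂ + 8 * c₂ + c₁ + 1)         ∎)
        where
        open ℕP.≤-Reasoning
        lemma₁ : ∀ r → 3 * r + r ≡ 2 * (2 * r)
        lemma₁ = ℕSolver.solve-∀
        lemma₂ : ∀ c₂ c₁ c₀ → suc (2 * (16 * c₂ + 8 * c₂ + c₁ + 1)) + (22 * c₁ + 3 * c₀ + 21) ≡ 3 * (16 * c₂ + 8 * c₁ + c₀) + 24
        lemma₂ = ℕSolver.solve-∀
        too-large : 2 * (16 * c₂ + 8 * c₂ + c₁ + 1) < 3 * (16 * c₂ + 8 * c₁ + c₀) + 24
        too-large = ℕP.≤-trans (ℕP.m≤m+n _ (22 * c₁ + 3 * c₀ + 21)) (ℕP.≤-reflexive (lemma₂ c₂ c₁ c₀))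
      next : ∃ λ d → q (suc (suc i)) ≡ + d × c₂ < d
      next = above-pos (ℤP.≰⇒> absurd)

    ∣coeffP-suc∣ : ∀ j → ∣ coeffP h (suc j) ∣ ≡ ∣ q (suc j) ∣
    ∣coeffP-suc∣ j = sym (trans (cong ∣_∣ (ℤP.+-identityˡ (ℤ.- coeffP h (suc j)))) (ℤP.∣-i∣≡∣i∣ (coeffP h (suc j))))

    ∣coeffP-0∣ : ∣ coeffP h 0 ∣ ≡ 1
    ∣coeffP-0∣ = cong ∣_∣ (trans (lemma (coeffP h 0)) (cong (λ y → 1ℤ ℤ.+ ℤ.- y) q-0))
      where
      lemma : ∀ y → y ≡ 1ℤ ℤ.+ ℤ.- (1ℤ ℤ.+ ℤ.- y)
      lemma = ℤSolver.solve-∀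

    ∣coeffP∣-increases : ∀ j → 3 * j + 1 ≤ twice h → ∣ coeffP h j ∣ < ∣ coeffP h (suc j) ∣
    ∣coeffP∣-increases zero    _     = begin-strict
      ∣ coeffP h 0 ∣    ≡⟨ ∣coeffP-0∣ ⟩
      1                 <⟨ proj₂ (proj₂ q-1) ⟩
      proj₁ q-1         ≡⟨ cong ∣_∣ (proj₁ (proj₂ q-1)) ⟨
      ∣ q 1 ∣           ≡⟨ ∣coeffP-suc∣ 0 ⟨
      ∣ coeffP h 1 ∣    ∎
      where open ℕP.≤-Reasoning
    ∣coeffP∣-increases (suc j) bound = begin-strict
      ∣ coeffP h (suc j) ∣        ≡⟨ trans (∣coeffP-suc∣ j) (cong ∣_∣ q₁) ⟩
      c₁                          <⟨ c₁<c₂ ⟩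
      c₂                          ≡⟨ trans (∣coeffP-suc∣ (suc j)) (cong ∣_∣ q₂) ⟨
      ∣ coeffP h (suc (suc j)) ∣  ∎
      where
      open ℕP.≤-Reasoning
      open Rising (rising (suc j) bound)

    ∣coeff∣-decreases : ∀ i j → suc i + j ≡ suc (twice h) → 3 * j + 1 ≤ twice h →
      ∣ coeff (seqP (twice h)) (suc i) ∣ < ∣ coeff (seqP (twice h)) i ∣
    ∣coeff∣-decreases i j eq bound = begin-strict
      ∣ coeff (seqP (twice h)) (suc i) ∣  ≡⟨ cong ∣_∣ (within P (suc i) j eq) ⟩
      ∣ coeffP h j ∣                      <⟨ ∣coeffP∣-increases j bound ⟩
      ∣ coeffP h (suc j) ∣                ≡⟨ cong ∣_∣ (within P i (suc j) (trans (ℕP.+-suc i j) eq)) ⟨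
      ∣ coeff (seqP (twice h)) i ∣        ∎
      where
      open ℕP.≤-Reasoning
      P = proj₂ (degree-P (twice h))

-- Steiner distances in a path and the order of B.

module SteinerDistances where
  open import Defs
  open PathDistances using (twice)
  open import Data.Bool using (true)
  open import Data.Empty using (⊥-elim)
  open import Data.Fin using (Fin; zero; suc; inject₁; fromℕ; fromℕ<; toℕ)
  import Data.Fin.Properties as FinP
  open import Data.Fin.Subset using (Subset; ⁅_⁆; _∪_; _∈_; _⊆_)
  open import Data.Fin.Subset.Properties using (x∈⁅x⁆; x∈⁅y⁆⇒x≡y; x∈p∪q⁻; x∈p∪q⁺; ∪-comm)
  open import Data.List using (List; []; _∷_; _++_; length; lookup; concatMap; tabulate)
  import Data.List.Membership.Propositional as List∈
  open import Data.List.Membership.Propositional.Properties using (∈-tabulate⁺)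
  open import Data.List.Properties using (length-tabulate)
  import Data.List.Relation.Unary.All as All
  import Data.List.Relation.Unary.All.Properties as AllP
  import Data.List.Relation.Unary.Any as Any
  open import Data.List.Relation.Unary.Any.Properties using (lookup-index)
  import Data.List.Relation.Unary.Unique.Propositional.Properties as UniqueP
  open import Data.Nat using (ℕ; zero; suc; _+_; _∸_; _≤_; _<_; z≤n; s≤s; _≤?_; _⊓_; _⊔_; ⌊_/2⌋; ⌈_/2⌉)
  import Data.Nat.Properties as ℕP
  open import Data.Product using (∃; ∃₂; _×_; _,_; proj₁; proj₂)
  open import Data.Sum using (_⊎_; inj₁; inj₂; [_,_]′)
  import Data.Vec as Vec
  import Data.Vec.Properties as VecP
  open import Function using (_∘_; id)
  open import Relation.Binary.Construct.Closure.ReflexiveTransitive using (Star; ε; _◅_; _◅◅_; reverse)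
  open import Relation.Binary.PropositionalEquality using (_≡_; refl; sym; trans; cong; subst)
  open import Relation.Nullary using (Dec; does; yes; no)
  open import Relation.Nullary.Decidable using (_×-dec_; dec-true)

  ∈-pair : ∀ {n} {u x y : Fin n} → u ∈ ⁅ x ⁆ ∪ ⁅ y ⁆ → u ≡ x ⊎ u ≡ y
  ∈-pair {x = x} {y} u∈ = [ (λ u∈x → inj₁ (x∈⁅y⁆⇒x≡y x u∈x)) , (λ u∈y → inj₂ (x∈⁅y⁆⇒x≡y y u∈y)) ]′ (x∈p∪q⁻ ⁅ x ⁆ ⁅ y ⁆ u∈)

  left∈pair : ∀ {n} (x y : Fin n) → x ∈ ⁅ x ⁆ ∪ ⁅ y ⁆
  left∈pair x y = x∈p∪q⁺ (inj₁ (x∈⁅x⁆ x))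

  right∈pair : ∀ {n} (x y : Fin n) → y ∈ ⁅ x ⁆ ∪ ⁅ y ⁆
  right∈pair x y = x∈p∪q⁺ (inj₂ (x∈⁅x⁆ y))

  ∈e : ∀ {m} {i : Fin m} {u} → u ∈ proj₁ (e i) → toℕ u ≡ toℕ i ⊎ toℕ u ≡ suc (toℕ i)
  ∈e {i = i} u∈ = [ (λ { refl → inj₁ (FinP.toℕ-inject₁ i) }) , (λ { refl → inj₂ refl }) ]′ (∈-pair {x = inject₁ i} {suc i} u∈)

  e-injective : ∀ {m} {i j : Fin m} → e i ≡ e j → i ≡ j
  e-injective {i = i} {j} ei≡ej = FinP.toℕ-injective (go
    (∈e (subst (λ p → inject₁ i ∈ proj₁ p) ei≡ej (left∈pair (inject₁ i) (suc i))))
    (∈e (subst (λ p → inject₁ j ∈ proj₁ p) (sym ei≡ej) (left∈pair (inject₁ j) (suc j)))))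
    where
    go : toℕ (inject₁ i) ≡ toℕ j ⊎ toℕ (inject₁ i) ≡ suc (toℕ j) →
         toℕ (inject₁ j) ≡ toℕ i ⊎ toℕ (inject₁ j) ≡ suc (toℕ i) → toℕ i ≡ toℕ j
    go (inj₁ p) _ = trans (sym (FinP.toℕ-inject₁ i)) p
    go (inj₂ _) (inj₁ p) = trans (sym p) (FinP.toℕ-inject₁ j)
    go (inj₂ p) (inj₂ q) = ⊥-elim (ℕP.m+1+n≢m (toℕ j) {1} (trans (ℕP.+-comm (toℕ j) 2)
      (trans (cong suc (sym (trans (sym (FinP.toℕ-inject₁ i)) p))) (trans (sym q) (FinP.toℕ-inject₁ j)))))

  module _ {m} (H : ConnectedSubgraph (Path (suc m))) where
    open ConnectedSubgraph H

    -- An edge of a path which crosses the cut between k and k + 1 is e k.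
    crossing : ∀ {u v} (k : Fin m) → toℕ u ≤ toℕ k → toℕ k < toℕ v → Star Adjacent u v → e k List∈.∈ edges
    crossing k u≤k k<v ε = ⊥-elim (ℕP.<⇒≱ k<v u≤k)
    crossing {u} {v} k u≤k k<v (_◅_ {j = w} (d , d∈ , d≡) rest) with toℕ w ≤? toℕ k
    ... | yes w≤k = crossing k w≤k k<v rest
    ... | no  w≰k with i , refl ← All.lookup edges⊆G d∈ = subst (λ i → e i List∈.∈ edges) (FinP.toℕ-injective i≡k) d∈
      where
      cases : toℕ u ≡ toℕ i ⊎ toℕ u ≡ suc (toℕ i) → toℕ w ≡ toℕ i ⊎ toℕ w ≡ suc (toℕ i) → toℕ i ≡ toℕ k
      cases (inj₁ p) (inj₁ q) = ⊥-elim (w≰k (subst (_≤ toℕ k) (trans p (sym q)) u≤k))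
      cases (inj₁ p) (inj₂ q) = ℕP.≤-antisym (subst (_≤ toℕ k) p u≤k) (ℕP.≤-pred (subst (toℕ k <_) q (ℕP.≰⇒> w≰k)))
      cases (inj₂ p) (inj₁ q) = ⊥-elim (w≰k (ℕP.≤-trans (ℕP.≤-reflexive q) (ℕP.≤-trans (ℕP.n≤1+n _) (subst (_≤ toℕ k) p u≤k))))
      cases (inj₂ p) (inj₂ q) = ⊥-elim (w≰k (subst (_≤ toℕ k) (trans p (sym q)) u≤k))
      i≡k : toℕ i ≡ toℕ k
      i≡k = cases (∈e (subst (u ∈_) (sym d≡) (left∈pair u w))) (∈e (subst (w ∈_) (sym d≡) (right∈pair u w)))

  does⁻ : ∀ {A : Set} (a? : Dec A) → does a? ≡ true → A
  does⁻ (yes a) _ = a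

  module Interval {m} (lo d : ℕ) (bound : lo + d ≤ m) where

    edgeIndex : Fin d → Fin m
    edgeIndex k = fromℕ< (ℕP.≤-trans (ℕP.+-monoʳ-< lo (FinP.toℕ<n k)) bound)

    toℕ-edgeIndex : ∀ k → toℕ (edgeIndex k) ≡ lo + toℕ k
    toℕ-edgeIndex k = FinP.toℕ-fromℕ< _

    edgeIndex-injective : ∀ {k k′} → edgeIndex k ≡ edgeIndex k′ → k ≡ k′
    edgeIndex-injective {k} {k′} eq = FinP.toℕ-injective (ℕP.+-cancelˡ-≡ lo _ _
      (trans (sym (toℕ-edgeIndex k)) (trans (cong toℕ eq) (toℕ-edgeIndex k′))))

    between? : (v : Fin (suc m)) → Dec (lo ≤ toℕ v × toℕ v ≤ lo + d)
    between? v = (lo ≤? toℕ v) ×-dec (toℕ v ≤? lo + d)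

    interval : Subset (suc m)
    interval = Vec.tabulate (does ∘ between?)

    ∈interval⁺ : ∀ {v} → lo ≤ toℕ v → toℕ v ≤ lo + d → v ∈ interval
    ∈interval⁺ {v} l≤v v≤h = VecP.lookup⇒[]= v interval
      (trans (VecP.lookup∘tabulate (does ∘ between?) v) (dec-true (between? v) (l≤v , v≤h)))

    ∈interval⁻ : ∀ {v} → v ∈ interval → lo ≤ toℕ v × toℕ v ≤ lo + d
    ∈interval⁻ {v} v∈ = does⁻ (between? v) (trans (sym (VecP.lookup∘tabulate (does ∘ between?) v)) (VecP.[]=⇒lookup v∈))

    intervalEdges : List (𝒱₂ (suc m))
    intervalEdges = tabulate (e ∘ edgeIndex)

    Adj : Fin (suc m) → Fin (suc m) → Set
    Adj u v = ∃ λ d → (d List∈.∈ intervalEdges) × (proj₁ d ≡ ⁅ u ⁆ ∪ ⁅ v ⁆)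

    Adj-sym : ∀ {u v} → Adj u v → Adj v u
    Adj-sym {u} {v} (d , d∈ , d≡) = d , d∈ , trans d≡ (∪-comm ⁅ u ⁆ ⁅ v ⁆)

    walk : ∀ k {u v} → k ≤ d → toℕ u ≡ lo → toℕ v ≡ lo + k → Star Adj u v
    walk zero    {u} {v} _   u≡ v≡ = subst (Star Adj u) (FinP.toℕ-injective (trans u≡ (sym (trans v≡ (ℕP.+-identityʳ lo))))) ε
    walk (suc k) {u} {v} k<d u≡ v≡ = walk k (ℕP.<⇒≤ k<d) u≡ toℕ-tail ◅◅ (step ◅ ε)
      where
      i : Fin m
      i = edgeIndex (fromℕ< k<d)
      toℕ-i : toℕ i ≡ lo + k
      toℕ-i = trans (toℕ-edgeIndex _) (cong (lo +_) (FinP.toℕ-fromℕ< k<d))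
      toℕ-tail : toℕ (inject₁ i) ≡ lo + k
      toℕ-tail = trans (FinP.toℕ-inject₁ i) toℕ-i
      step : Adj (inject₁ i) v
      step = e i , ∈-tabulate⁺ {f = e ∘ edgeIndex} (fromℕ< k<d) ,
        cong (λ w → ⁅ inject₁ i ⁆ ∪ ⁅ w ⁆) (FinP.toℕ-injective (trans (cong suc toℕ-i) (trans (sym (ℕP.+-suc lo k)) (sym v≡))))

    subgraph : ConnectedSubgraph (Path (suc m))
    subgraph = record
      { vertices  = interval
      ; edges     = intervalEdges
      ; unique    = UniqueP.tabulate⁺ (edgeIndex-injective ∘ e-injective)
      ; edges⊆G   = AllP.tabulate⁺ λ k → edgeIndex k , refl
      ; ends      = AllP.tabulate⁺ ends
      ; connected = λ u∈ v∈ → reverse Adj-sym (fromStart u∈) ◅◅ fromStart v∈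
      }
      where
      ends : ∀ k → proj₁ (e (edgeIndex k)) ⊆ interval
      ends k {u} u∈ = [ (λ p → ∈interval⁺ (subst (lo ≤_) (sym (trans p (toℕ-edgeIndex k))) (ℕP.m≤m+n lo _))
                                    (subst (_≤ lo + d) (sym (trans p (toℕ-edgeIndex k))) (ℕP.+-monoʳ-≤ lo (ℕP.<⇒≤ (FinP.toℕ<n k)))))
                      , (λ p → ∈interval⁺ (subst (lo ≤_) (sym (head p)) (ℕP.m≤m+n lo _))
                                    (subst (_≤ lo + d) (sym (head p)) (ℕP.+-monoʳ-≤ lo (FinP.toℕ<n k)))) ]′ (∈e u∈)
        where
        head : toℕ u ≡ suc (toℕ (edgeIndex k)) → toℕ u ≡ lo + suc (toℕ k)
        head p = trans p (trans (cong suc (toℕ-edgeIndex k)) (sym (ℕP.+-suc lo (toℕ k))))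
      start : Fin (suc m)
      start = fromℕ< (s≤s (ℕP.≤-trans (ℕP.m≤m+n lo d) bound))
      fromStart : ∀ {v} → v ∈ interval → Star Adj start v
      fromStart {v} v∈ with l≤v , v≤h ← ∈interval⁻ v∈ = walk (toℕ v ∸ lo)
        (ℕP.≤-trans (ℕP.∸-monoˡ-≤ lo v≤h) (ℕP.≤-reflexive (ℕP.m+n∸m≡n lo d))) (FinP.toℕ-fromℕ< _) (sym (ℕP.m+[n∸m]≡n l≤v))

    -- The interval attains d. Conversely, a connected subgraph containing both extreme vertices
    -- joins them by a walk, which crosses each of the d cuts between them.
    isSteinerDistance : ∀ S {x y} → x ∈ S → y ∈ S → toℕ x ≡ lo → toℕ y ≡ lo + d →
      (∀ {v} → v ∈ S → lo ≤ toℕ v × toℕ v ≤ lo + d) → IsSteinerDistance (Path (suc m)) S d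
    isSteinerDistance S {x} {y} x∈ y∈ x≡ y≡ inside =
      (subgraph , (λ v∈ → ∈interval⁺ (proj₁ (inside v∈)) (proj₂ (inside v∈))) , length-tabulate (e ∘ edgeIndex)) ,
      λ { _ (H , S⊆H , refl) → minimal H S⊆H }
      where
      minimal : ∀ H → S ⊆ ConnectedSubgraph.vertices H → d ≤ length (ConnectedSubgraph.edges H)
      -- The d edges are distinct, so they occupy distinct positions in the edge list.
      minimal H S⊆H = FinP.injective⇒≤ {f = Any.index ∘ member} λ {k} {k′} eq →
        edgeIndex-injective (e-injective (trans (lookup-index (member k))
          (trans (cong (lookup edges) eq) (sym (lookup-index (member k′))))))
        where
        open ConnectedSubgraph H
        member : ∀ k → e (edgeIndex k) List∈.∈ edges
        member k = crossing H (edgeIndex k)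
          (ℕP.≤-trans (ℕP.≤-reflexive x≡) (ℕP.≤-trans (ℕP.m≤m+n lo (toℕ k)) (ℕP.≤-reflexive (sym (toℕ-edgeIndex k)))))
          (subst (toℕ (edgeIndex k) <_) (sym y≡) (subst (_< lo + d) (sym (toℕ-edgeIndex k)) (ℕP.+-monoʳ-< lo (FinP.toℕ<n k))))
          (connected (S⊆H x∈) (S⊆H y∈))

  steiner-unique : ∀ {n} {G : Graph n} {S d d′} → IsSteinerDistance G S d → IsSteinerDistance G S d′ → d ≡ d′
  steiner-unique (Pd , d-min) (Pd′ , d′-min) = ℕP.≤-antisym (d-min _ Pd′) (d′-min _ Pd)

  Spans : ∀ {n} → 𝒱₂ n → ℕ → ℕ → Set
  Spans p l r = ∃₂ λ x y → proj₁ p ≡ ⁅ x ⁆ ∪ ⁅ y ⁆ × toℕ x ≡ l × toℕ y ≡ r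

  spans-left : ∀ {n} {p : 𝒱₂ n} {l r} → Spans p l r → ∃ λ x → x ∈ proj₁ p × toℕ x ≡ l
  spans-left (x , y , p≡ , x≡ , y≡) = x , subst (x ∈_) (sym p≡) (left∈pair x y) , x≡

  spans-right : ∀ {n} {p : 𝒱₂ n} {l r} → Spans p l r → ∃ λ x → x ∈ proj₁ p × toℕ x ≡ r
  spans-right (x , y , p≡ , x≡ , y≡) = y , subst (y ∈_) (sym p≡) (right∈pair x y) , y≡

  spans-between : ∀ {n} {p : 𝒱₂ n} {l r} → Spans p l r → l ≤ r → ∀ {v} → v ∈ proj₁ p → l ≤ toℕ v × toℕ v ≤ r
  spans-between (x , y , p≡ , refl , refl) l≤r {v} v∈ with ∈-pair (subst (v ∈_) p≡ v∈)
  ... | inj₁ refl = ℕP.≤-refl , l≤r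
  ... | inj₂ refl = l≤r , ℕP.≤-refl

  -- The hull of two intervals has both its ends in the union of the two pairs, and all four
  -- vertices lie between them.
  steiner-spans : ∀ {m} {p q : 𝒱₂ (suc m)} {l r l′ r′} → l ≤ r → l′ ≤ r′ → Spans p l r → Spans q l′ r′ →
    IsSteinerDistance (Path (suc m)) (proj₁ p ∪ proj₁ q) ((r ⊔ r′) ∸ (l ⊓ l′))
  steiner-spans {m} {p} {q} {l} {r} {l′} {r′} l≤r l′≤r′ sp sq =
    Interval.isSteinerDistance lo (hi ∸ lo) bound (proj₁ p ∪ proj₁ q) (proj₁ (proj₂ leftmost)) (proj₁ (proj₂ rightmost))
      (proj₂ (proj₂ leftmost)) (trans (proj₂ (proj₂ rightmost)) (sym lo+d≡hi)) inside
    where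
    lo hi : ℕ
    lo = l ⊓ l′
    hi = r ⊔ r′
    lo+d≡hi : lo + (hi ∸ lo) ≡ hi
    lo+d≡hi = ℕP.m+[n∸m]≡n (ℕP.≤-trans (ℕP.m⊓n≤m l l′) (ℕP.≤-trans l≤r (ℕP.m≤m⊔n r r′)))
    leftmost : ∃ λ x → x ∈ proj₁ p ∪ proj₁ q × toℕ x ≡ lo
    leftmost with ℕP.⊓-sel l l′
    ... | inj₁ eq = let x , x∈ , x≡ = spans-left {p = p} sp in x , x∈p∪q⁺ (inj₁ x∈) , trans x≡ (sym eq)
    ... | inj₂ eq = let x , x∈ , x≡ = spans-left {p = q} sq in x , x∈p∪q⁺ (inj₂ x∈) , trans x≡ (sym eq)
    rightmost : ∃ λ x → x ∈ proj₁ p ∪ proj₁ q × toℕ x ≡ hi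
    rightmost with ℕP.⊔-sel r r′
    ... | inj₁ eq = let x , x∈ , x≡ = spans-right {p = p} sp in x , x∈p∪q⁺ (inj₁ x∈) , trans x≡ (sym eq)
    ... | inj₂ eq = let x , x∈ , x≡ = spans-right {p = q} sq in x , x∈p∪q⁺ (inj₂ x∈) , trans x≡ (sym eq)
    bound : lo + (hi ∸ lo) ≤ m
    bound = subst (_≤ m) (trans (proj₂ (proj₂ rightmost)) (sym lo+d≡hi)) (ℕP.≤-pred (FinP.toℕ<n (proj₁ rightmost)))
    inside : ∀ {v} → v ∈ proj₁ p ∪ proj₁ q → lo ≤ toℕ v × toℕ v ≤ lo + (hi ∸ lo)
    inside v∈ with x∈p∪q⁻ (proj₁ p) (proj₁ q) v∈
    ... | inj₁ v∈p = let a , b = spans-between {p = p} sp l≤r v∈p in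
      ℕP.≤-trans (ℕP.m⊓n≤m l l′) a , ℕP.≤-trans (ℕP.≤-trans b (ℕP.m≤m⊔n r r′)) (ℕP.≤-reflexive (sym lo+d≡hi))
    ... | inj₂ v∈q = let a , b = spans-between {p = q} sq l′≤r′ v∈q in
      ℕP.≤-trans (ℕP.m⊓n≤n l l′) a , ℕP.≤-trans (ℕP.≤-trans b (ℕP.m≤n⊔m r r′)) (ℕP.≤-reflexive (sym lo+d≡hi))

  left right : ℕ → ℕ
  left  r = ⌊ r /2⌋
  right r = suc ⌈ r /2⌉

  left≤right : ∀ r → left r ≤ right r
  left≤right r = ℕP.m≤n⇒m≤1+n (ℕP.⌊n/2⌋≤⌈n/2⌉ r)

  -- The index is the number that the head of the list has in B, so that tails of B have a layout as
  -- well.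
  data Layout {n} : ℕ → List (𝒱₂ n) → Set where
    []  : ∀ {s} → Layout s []
    _∷_ : ∀ {s p L} → Spans p (left s) (right s) → Layout (suc s) L → Layout s (p ∷ L)

  layout-lookup : ∀ {n s} {L : List (𝒱₂ n)} → Layout s L → ∀ r → Spans (lookup L r) (left (s + toℕ r)) (right (s + toℕ r))
  layout-lookup {s = s} (sp ∷ _) zero    rewrite ℕP.+-identityʳ s = sp
  layout-lookup {s = s} (_ ∷ ly) (suc r) rewrite ℕP.+-suc s (toℕ r) = layout-lookup ly r

  left-twice : ∀ a → left (twice a) ≡ a × left (suc (twice a)) ≡ a
  left-twice zero    = refl , refl
  left-twice (suc a) = cong suc (proj₁ (left-twice a)) , cong suc (proj₂ (left-twice a))

  e-spans : ∀ {m} (i : Fin m) {a} → toℕ i ≡ a → Spans (e i) (left (twice a)) (right (twice a))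
  e-spans i {a} i≡a = inject₁ i , suc i , refl ,
    trans (FinP.toℕ-inject₁ i) (trans i≡a (sym (proj₁ (left-twice a)))) ,
    cong suc (trans i≡a (sym (proj₂ (left-twice a))))

  f-spans : ∀ {m} (i : Fin m) {a} → toℕ i ≡ a → Spans (f i) (left (suc (twice a))) (right (suc (twice a)))
  f-spans i {a} i≡a = inject₁ (inject₁ i) , suc (suc i) , refl ,
    trans (FinP.toℕ-inject₁ (inject₁ i)) (trans (FinP.toℕ-inject₁ i) (trans i≡a (sym (proj₂ (left-twice a))))) ,
    cong (2 +_) (trans i≡a (sym (proj₁ (left-twice a))))

  -- `allFin` tabulates the identity, whose restriction to a tail is no longer the identity; hence
  -- the general φ that adds an offset a.
  layout-prefix : ∀ {m} k (φ : Fin k → Fin m) {a L} → (∀ i → toℕ (φ i) ≡ a + toℕ i) → Layout (twice (a + k)) L →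
    Layout (twice a) (concatMap (λ j → e (inject₁ j) ∷ f j ∷ []) (tabulate φ) ++ L)
  layout-prefix zero    φ {a} {L} φ≡ ly = subst (λ b → Layout (twice b) L) (ℕP.+-identityʳ a) ly
  layout-prefix (suc k) φ {a} {L} φ≡ ly =
    e-spans (inject₁ (φ zero)) (trans (FinP.toℕ-inject₁ (φ zero)) φ₀) ∷ f-spans (φ zero) φ₀ ∷
    layout-prefix k (φ ∘ suc) (λ i → trans (φ≡ (suc i)) (ℕP.+-suc a (toℕ i))) (subst (λ b → Layout (twice b) L) (ℕP.+-suc a k) ly)
    where
    φ₀ : toℕ (φ zero) ≡ a
    φ₀ = trans (φ≡ zero) (ℕP.+-identityʳ a)

  B-layout : ∀ m → Layout 0 (B (suc (suc m)))
  B-layout m = layout-prefix m id {0} (λ _ → refl) (e-spans (fromℕ m) (FinP.toℕ-fromℕ m) ∷ [])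

  length-prefix : ∀ {m} k (φ : Fin k → Fin m) z →
    length (concatMap (λ j → e (inject₁ j) ∷ f j ∷ []) (tabulate φ) ++ z ∷ []) ≡ suc (twice k)
  length-prefix zero    φ z = refl
  length-prefix (suc k) φ z = cong (2 +_) (length-prefix k (φ ∘ suc) z)

  length-B : ∀ m → length (B (suc (suc m))) ≡ suc (twice m)
  length-B m = length-prefix m id (e (fromℕ m))

-- Assembly: the given matrix, its characteristic polynomial and the peak.

open import Defs
open import Data.Bool using (true; false)
open import Data.Empty using (⊥-elim)
open import Data.Fin using (Fin; zero; suc; toℕ; punchIn)
import Data.Fin.Properties as FinP
open import Data.Integer using (+_; ∣_∣; 1ℤ)
open import Data.List using (applyUpTo; lookup; length)
open import Data.List.Extrema.Nat using (max; xs≤max)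
open import Data.List.Membership.Propositional.Properties using (∈-applyUpTo⁺)
import Data.List.Relation.Unary.All as All
open import Data.Nat using (ℕ; zero; suc; _+_; _*_; _∸_; _≤_; _<_; z≤n; s≤s; _≤?_; _⊓_; _⊔_; ⌊_/2⌋; ⌈_/2⌉)
open import Data.Nat.DivMod using (_/_; /-monoˡ-≤; m*n/n≡m)
import Data.Nat.Properties as ℕP
import Data.Nat.Tactic.RingSolver as ℕSolver
open import Relation.Binary.PropositionalEquality using (_≡_; _≢_; refl; sym; trans; cong; subst; subst₂)
open import Relation.Nullary using (yes; no)
open import Algebra.Bundles using (RawRing)
import Algebra.Definitions.RawSemiring as RawSemiringDefs

open Polynomials
open PathDistances
open Coefficients using (const-hom; module Increase)
open SteinerDistances
open Determinants polyRing const-hom using (Matrix; Det; minor; skip; sgn; ∑)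
open Transfer polyRing const-hom X using (κ; diagonal; entry; seqP; Det-entry)
open RawSemiringDefs (RawRing.rawSemiring ℤ[X]) using (sum; _^_)
open _≋_
private module P = CommutativeRing polyRing

tally≡ : ∀ c → tally true c ≡ ⌈ c /2⌉
tally≡′ : ∀ c → tally false c ≡ ⌊ c /2⌋
tally≡ zero    = refl
tally≡ (suc c) = cong suc (tally≡′ c)
tally≡′ zero    = refl
tally≡′ (suc c) = tally≡ c

dist-steiner : ∀ r c → (right r ⊔ right c) ∸ (left r ⊓ left c) ≡ dist true r c
dist-steiner zero          c             = cong suc (sym (tally≡ c))
dist-steiner (suc zero)    zero          = refl
dist-steiner (suc zero)    (suc c)       = cong (λ y → suc (suc y)) (sym (tally≡′ c))
dist-steiner (suc (suc r)) zero          = cong suc (sym (tally≡ (suc (suc r))))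
dist-steiner (suc (suc r)) (suc zero)    = cong (λ y → suc (suc y)) (trans (ℕP.⊔-identityʳ _) (sym (tally≡ r)))
-- Two numbers later both intervals have moved by one vertex, which leaves the hull length
-- unchanged, and the alternation in `dist` has been flipped twice.
dist-steiner (suc (suc r)) (suc (suc c)) = dist-steiner r c

toℕ-punchIn : ∀ {n} (j : Fin (suc n)) c → toℕ (punchIn j c) ≡ skip (toℕ j) (toℕ c)
toℕ-punchIn zero    c       = refl
toℕ-punchIn (suc j) zero    = refl
toℕ-punchIn (suc j) (suc c) = cong suc (toℕ-punchIn j c)

sum≋∑ : ∀ n {g : Fin n → Poly} {f : ℕ → Poly} → (∀ j → g j ≋ f (toℕ j)) → sum g ≋ ∑ n f
sum≋∑ zero    g≋f = P.refl
sum≋∑ (suc n) g≋f = +ₚ-cong (g≋f zero) (sum≋∑ n λ j → g≋f (suc j))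

sign≋sgn : ∀ j → (-ₚ const 1ℤ) ^ j ≋ sgn j
sign≋sgn zero    = P.refl
sign≋sgn (suc j) = P.trans (P.*-congˡ { -ₚ const 1ℤ} (sign≋sgn j)) (-1*x≈-x (sgn j))
  where open import Algebra.Properties.Ring P.ring using (-1*x≈-x)

-- The indices trade places because a `Matrix` takes its column first; both determinants expand
-- along the first row.
det≋Det : ∀ s (M : Fin s → Fin s → Poly) (N : Matrix) → (∀ r c → M r c ≋ N (toℕ c) (toℕ r)) →
  Determinant.det ℤ[X] M ≋ Det s N
det≋Det zero    M N M≋N = P.refl
det≋Det (suc s) M N M≋N = sum≋∑ (suc s) {f = λ j → sgn j *ₚ (N j 0 *ₚ Det s (minor j N))} λ j →
  *ₚ-cong (sign≋sgn (toℕ j)) (*ₚ-cong (M≋N zero j) (det≋Det s _ (minor (toℕ j) N) λ r c → P.trans (M≋N (suc r) (punchIn j c))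
    (P.reflexive (cong (λ k → N k (suc (toℕ r))) (toℕ-punchIn j c)))))

diagonal-≡ : ∀ r → diagonal r r ≡ X
diagonal-≡ zero    = refl
diagonal-≡ (suc r) = diagonal-≡ r

diagonal-≢ : ∀ r c → r ≢ c → diagonal r c ≡ κ 0
diagonal-≢ zero    zero    r≢c = ⊥-elim (r≢c refl)
diagonal-≢ zero    (suc c) r≢c = refl
diagonal-≢ (suc r) zero    r≢c = refl
diagonal-≢ (suc r) (suc c) r≢c = diagonal-≢ r c λ r≡c → r≢c (cong suc r≡c)

XI≋diagonal : ∀ {m} (r c : Fin m) → XI r c ≋ diagonal (toℕ r) (toℕ c)
XI≋diagonal r c with r FinP.≟ c
... | yes refl = P.reflexive (sym (diagonal-≡ (toℕ r)))
... | no  r≢c  = P.trans (P.sym 0∷[]≋[]) (P.reflexive (sym (diagonal-≢ (toℕ r) (toℕ c) λ eq → r≢c (FinP.toℕ-injective eq))))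

charPoly≋seqP : ∀ h (𝔇₂ : 𝒱₂ (suc (suc h)) → 𝒱₂ (suc (suc h)) → ℕ) → Is𝔇₂ (Path (suc (suc h))) 𝔇₂ →
  charPoly (principal (λ p q → + 𝔇₂ p q) (B (suc (suc h)))) ≋ seqP (twice h)
charPoly≋seqP h 𝔇₂ is𝔇₂ = P.trans (det≋Det (length L) _ (entry true) entries)
  (P.trans (P.reflexive (cong (λ s → Det s (entry true)) (length-B h))) (Det-entry (twice h)))
  where
  L = B (suc (suc h))
  distance : ∀ r c → 𝔇₂ (lookup L r) (lookup L c) ≡ dist true (toℕ r) (toℕ c)
  distance r c = trans (steiner-unique {G = Path (suc (suc h))} (is𝔇₂ (lookup L r) (lookup L c))
    (steiner-spans {p = lookup L r} {lookup L c} (left≤right (toℕ r)) (left≤right (toℕ c))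
      (layout-lookup (B-layout h) r) (layout-lookup (B-layout h) c)))
    (dist-steiner (toℕ r) (toℕ c))
  entries : ∀ r c → XI r c +ₚ (-ₚ const (+ 𝔇₂ (lookup L r) (lookup L c))) ≋ entry true (toℕ c) (toℕ r)
  entries r c = +ₚ-cong (XI≋diagonal r c) (P.reflexive (cong (λ d → -ₚ const (+ d)) (distance r c)))

-- A degree above 7n/5 has a codegree j with 5j + 10 ≤ 3h. Since 3/5 < 2/3, this lies within the
-- range in which the coefficients increase.
codegree-bound : ∀ h ℓ j → ℓ + j ≡ suc (2 * h) → 7 * (2 + h) < ℓ * 5 → 3 * j + 1 ≤ 2 * h
codegree-bound h ℓ j ℓ+j≡ 7n<5ℓ = ℕP.≤-trans (ℕP.+-monoʳ-≤ (3 * j) (s≤s z≤n)) (ℕP.*-cancelˡ-≤ 5 (begin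
  5 * (3 * j + 6)     ≡⟨ lemma₁ j ⟩
  3 * (5 * j + 10)    ≤⟨ ℕP.*-monoʳ-≤ 3 5j+10≤3h ⟩
  3 * (3 * h)         ≤⟨ ℕP.m≤m+n _ h ⟩
  3 * (3 * h) + h     ≡⟨ lemma₂ h ⟩
  5 * (2 * h)         ∎))
  where
  open ℕP.≤-Reasoning
  lemma₁ : ∀ j → 5 * (3 * j + 6) ≡ 3 * (5 * j + 10)
  lemma₁ = ℕSolver.solve-∀
  lemma₂ : ∀ h → 3 * (3 * h) + h ≡ 5 * (2 * h)
  lemma₂ = ℕSolver.solve-∀
  lemma₃ : ∀ h j → (5 * j + 10) + (7 * h + 5) ≡ suc (7 * (2 + h)) + 5 * j
  lemma₃ = ℕSolver.solve-∀
  lemma₄ : ∀ ℓ j → ℓ * 5 + 5 * j ≡ 5 * (ℓ + j)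
  lemma₄ = ℕSolver.solve-∀
  lemma₅ : ∀ h → 5 * suc (2 * h) ≡ 3 * h + (7 * h + 5)
  lemma₅ = ℕSolver.solve-∀
  5j+10≤3h : 5 * j + 10 ≤ 3 * h
  5j+10≤3h = ℕP.+-cancelʳ-≤ (7 * h + 5) _ _ (begin
    (5 * j + 10) + (7 * h + 5)   ≡⟨ lemma₃ h j ⟩
    suc (7 * (2 + h)) + 5 * j    ≤⟨ ℕP.+-monoˡ-≤ (5 * j) 7n<5ℓ ⟩
    ℓ * 5 + 5 * j                ≡⟨ lemma₄ ℓ j ⟩
    5 * (ℓ + j)                  ≡⟨ cong (5 *_) ℓ+j≡ ⟩
    5 * suc (2 * h)              ≡⟨ lemma₅ h ⟩
    3 * h + (7 * h + 5)          ∎)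

-- A peak at suc i beyond the bound would be smaller than its neighbour at i. That neighbour belongs
-- to the list under the maximum even when suc i = m, since the list stops at m - 1.
peak-bound : ∀ (a : ℕ → ℕ) m N → (∀ i → suc i ≤ m → N < suc i * 5 → a (suc i) < a i) →
  ∀ ℓ → ℓ ≤ m → a ℓ ≡ max 0 (applyUpTo a m) → ℓ ≤ N / 5
peak-bound a m N drop ℓ ℓ≤m aℓ≡max with ℓ * 5 ≤? N
... | yes 5ℓ≤N = subst (_≤ N / 5) (m*n/n≡m ℓ 5) (/-monoˡ-≤ 5 5ℓ≤N)
peak-bound a m N drop zero    ℓ≤m aℓ≡max | no _ = z≤n
peak-bound a m N drop (suc i) ℓ≤m aℓ≡max | no 5ℓ≰N = ⊥-elim (ℕP.<⇒≱ (drop i ℓ≤m (ℕP.≰⇒> 5ℓ≰N)) (begin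
  a i                        ≤⟨ All.lookup (xs≤max 0 (applyUpTo a m)) (∈-applyUpTo⁺ a ℓ≤m) ⟩
  max 0 (applyUpTo a m)      ≡⟨ aℓ≡max ⟨
  a (suc i)                  ∎))
  where open ℕP.≤-Reasoning

seqP-drops : ∀ h′ → let h = suc h′ in ∀ i → suc i ≤ 2 * (2 + h) ∸ 3 → 7 * (2 + h) < suc i * 5 →
  ∣ coeff (seqP (twice h)) (suc i) ∣ < ∣ coeff (seqP (twice h)) i ∣
seqP-drops h′ i ℓ≤m 7n<5ℓ = Increase.∣coeff∣-decreases h′ i j (trans ℓ+j≡ (cong suc (sym (twice≡2* h))))
  (subst (3 * j + 1 ≤_) (sym (twice≡2* h)) (codegree-bound h (suc i) j ℓ+j≡ 7n<5ℓ))
  where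
  h j : ℕ
  h = suc h′
  j = 2 * (2 + h) ∸ 3 ∸ suc i
  lemma : ∀ h → 2 * (2 + h) ≡ 3 + suc (2 * h)
  lemma = ℕSolver.solve-∀
  ℓ+j≡ : suc i + j ≡ suc (2 * h)
  ℓ+j≡ = trans (ℕP.m+[n∸m]≡n ℓ≤m) (trans (cong (_∸ 3) (lemma h)) (ℕP.m+n∸m≡n 3 (suc (2 * h))))

theorem5p14 : ∀ (n : ℕ) → 2 < n →
    ∀ (𝔇₂ : 𝒱₂ n → 𝒱₂ n → ℕ) → Is𝔇₂ (Path n) 𝔇₂ →
    let a = coeff (charPoly (principal (λ p q → + 𝔇₂ p q) (B n))) in
    ∀ (ℓ : ℕ) → ℓ ≤ 2 * n ∸ 3 →
    ∣ a ℓ ∣ ≡ max 0 (applyUpTo (λ i → ∣ a i ∣) (2 * n ∸ 3)) →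
    ℓ ≤ (7 * n) / 5
theorem5p14 (suc zero)       (s≤s ())
theorem5p14 (suc (suc zero)) (s≤s (s≤s ()))
theorem5p14 n@(suc (suc (suc h′))) _ 𝔇₂ is𝔇₂ = peak-bound _ (2 * n ∸ 3) (7 * n) λ i ℓ≤m 7n<5ℓ →
  subst₂ _<_ (sym (coeff≡ (suc i))) (sym (coeff≡ i)) (seqP-drops h′ i ℓ≤m 7n<5ℓ)
  where
  coeff≡ : ∀ i → ∣ coeff (charPoly (principal (λ p q → + 𝔇₂ p q) (B n))) i ∣ ≡ ∣ coeff (seqP (twice (suc h′))) i ∣
  coeff≡ i = cong ∣_∣ (at (charPoly≋seqP (suc h′) 𝔇₂ is𝔇₂) i)
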